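{- Let $p<q<r$ be odd primes and let $\Psi_{pqr}(x)=\prod_{1\le j\le pqr,\ \gcd(j,pqr)>1}(x-\zeta_{pqr}^j)$, where $\zeta_{pqr}$ is a primitive $pqr$-th root of unity. Then $h(\Psi_{pqr}(x))=p-1$ if and only if $$\text{either } q\equiv r\equiv 1 \pmod p \text{ or } q\equiv r\equiv -1\pmod p,\quad\text{and}\quad r<\frac{(p-1)}{(p-2)}(q-1).$$ In all remaining cases $h(\Psi_{pqr}(x))<p-1$.
   Context: For a polynomial $f\in\mathbb Z[x]$, the height $h(f)$ is the maximum of the absolute values of its coefficients. Equivalently $\Psi_n(x)=(x^n-1)/\Phi_n(x)$, where $\Phi_n$ is the $n$-th cyclotomic polynomial; $\Psi_n$ has integer coefficients. -}

module Defs where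

open import Data.Nat as ℕ using (ℕ; zero; suc; _∸_; _⊔_)
open import Data.Nat.Divisibility using (_∣?_)
open import Data.Integer as ℤ using (ℤ; +_; -[1+_]; ∣_∣)
open import Data.List using (List; []; _∷_; _++_; [_]; reverse; length; replicate; foldr; map; upTo)
open import Data.Bool using (if_then_else_)
open import Relation.Nullary.Decidable using (⌊_⌋)

-- Integer polynomials as coefficient lists, lowest degree first.
Poly : Set
Poly = List ℤ

infixl 6 _+ₚ_
_+ₚ_ : Poly → Poly → Poly
[] +ₚ g = g
(a ∷ f) +ₚ [] = a ∷ f
(a ∷ f) +ₚ (b ∷ g) = (a ℤ.+ b) ∷ (f +ₚ g)

shift : Poly → Poly
shift [] = []
shift f = + 0 ∷ f

infixl 7 _*ₚ_
_*ₚ_ : Poly → Poly → Poly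
[] *ₚ g = []
(a ∷ f) *ₚ g = map (a ℤ.*_) g +ₚ shift (f *ₚ g)

oneₚ : Poly
oneₚ = + 1 ∷ []

xⁿ-1 : ℕ → Poly
xⁿ-1 zero = []
xⁿ-1 (suc n) = -[1+ 0 ] ∷ (replicate n (+ 0) ++ [ + 1 ])

at : {A : Set} → A → List A → ℕ → A
at d [] _ = d
at d (x ∷ xs) zero = x
at d (x ∷ xs) (suc i) = at d xs i

sumℤ : ℕ → (ℕ → ℤ) → ℤ
sumℤ zero f = + 0
sumℤ (suc n) f = sumℤ n f ℤ.+ f n

-- Exact division f / g by a monic g (quotient by polynomial long division;
-- remainder discarded -- all uses below are exact divisions).
divMonic : Poly → Poly → Poly
divMonic f g = reverse (loop (suc (length F ∸ length G)) [])
  where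
  F = reverse f
  G = reverse g   -- leading coefficient first; at G 0 = 1
  next : List ℤ → ℤ
  next acc = at (+ 0) F i ℤ.- sumℤ i (λ j → at (+ 0) G (suc j) ℤ.* at (+ 0) acc (i ∸ suc j))
    where i = length acc
  loop : ℕ → List ℤ → List ℤ
  loop zero acc = acc
  loop (suc k) acc = loop k (acc ++ [ next acc ])

prodDiv : ℕ → ℕ → List Poly → Poly
prodDiv m n T = foldr (λ k acc → (if ⌊ suc k ∣? m ⌋ then at oneₚ T k else oneₚ) *ₚ acc) oneₚ (upTo n)

-- cycTable n = [Φ₁, …, Φₙ],  Φₘ = (xᵐ - 1) / ∏_{d ∣ m, d < m} Φ_d
cycTable : ℕ → List Poly
cycTable zero = []
cycTable (suc n) = cycTable n ++ [ divMonic (xⁿ-1 (suc n)) (prodDiv (suc n) n (cycTable n)) ]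

-- n-th cyclotomic polynomial (n ≥ 1)
Φ : ℕ → Poly
Φ n = at oneₚ (cycTable n) (n ∸ 1)

Ψ : ℕ → Poly
Ψ n = divMonic (xⁿ-1 n) (Φ n)

height : Poly → ℕ
height = foldr (λ a m → ∣ a ∣ ⊔ m) 0

{-# OPTIONS --safe #-}

-- Dividing out cyclotomic factors gives
--   Ψ_pqr(x) = (x^(qr) - 1) (1 + x^r + … + x^((p-1)r)) Φ_pq(x).
-- Since deg Φ_pq = (p - 1)(q - 1) < (p - 1) r, each coefficient of Ψ_pqr is, up to sign, a sum of at
-- most p - 1 coefficients of Φ_pq, all of them 0 or ±1. Height p - 1 therefore means that Φ_pq has the
-- same coefficient ±1 in p - 1 degrees m, m + r, …, m + (p - 2) r. By
--   Φ_pq = Σ_{i<α, j<γ} x^(pi+qj) - x Σ_{i<q-α, j<p-γ} x^(pi+qj),   p α + q γ = p q + 1,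
-- the values of j in these degrees are distinct modulo p, which forces γ = p - 1 or γ = 1, and then
-- they are 0, 1, …, p - 2 in this order; so p divides r - q and q + 1, respectively q - 1.
module Submission where

open import Defs
open import Data.Nat using (ℕ; _+_; _*_; _∸_; _<_)
open import Data.Nat.Divisibility using (_∣_)
open import Data.Nat.Primality using (Prime)
open import Data.Product using (_×_)
open import Data.Sum using (_⊎_)
open import Relation.Nullary using (¬_)
open import Relation.Binary.PropositionalEquality using (_≡_)
open import Function.Bundles using (_⇔_)

import Algebra.Solver.Ring as RingSolver
import Algebra.Solver.Ring.AlmostCommutativeRing as ACR
open import Algebra.Bundles using (CommutativeRing)
open import Data.Bool using (Bool; true; false; if_then_else_)
open import Data.Empty using (⊥; ⊥-elim)
open import Data.Fin using (Fin; toℕ; fromℕ<)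
open import Data.Fin.Properties using (injective⇒≤; toℕ-injective; toℕ-fromℕ<; toℕ≤pred[n])
open import Data.Integer as ℤ using (ℤ; +_; -[1+_])
import Data.Integer.Properties as ℤₚ
open import Data.Integer.Tactic.RingSolver using () renaming (solve-∀ to ℤ-solve-∀)
open import Data.List using (List; []; _∷_; _++_; [_]; reverse; length; replicate; foldr; map; upTo; applyUpTo)
import Data.List.Properties as Listₚ
open import Data.List.Membership.Propositional using (_∈_; _∉_)
open import Data.List.Relation.Unary.All as All using (All; []; _∷_)
open import Data.List.Relation.Unary.AllPairs using ([]; _∷_)
open import Data.List.Relation.Unary.Any using (here; there)
open import Data.List.Relation.Unary.Unique.Propositional using (Unique)
open import Data.Maybe using (Maybe; just; nothing)
open import Data.Nat as ℕ using (zero; suc; _≤_; _⊔_; _≤?_; _<?_; _≡ᵇ_; z≤n; s≤s)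
import Data.Nat.Properties as ℕₚ
open import Data.List.Membership.DecPropositional ℕ._≟_ using (_∈?_)
open import Data.Nat.Coprimality using (Coprime; coprime-Bézout; coprime-divisor)
open import Data.Nat.DivMod using (_%_; _/_; m%n<n; m≡m%n+[m/n]*n; %-distribˡ-*; m<n⇒m%n≡m; [m+kn]%n≡m%n)
open import Data.Nat.Divisibility using
  (_∣?_; divides; ∣⇒≤; ∣1⇒≡1; 1∣_; m∣m*n; n∣m*n; ∣-refl; ∣m∣n⇒∣m+n; ∣m+n∣m⇒∣n; *-cancelˡ-∣)
open import Data.Nat.GCD using (module Bézout)
open import Data.Nat.Primality using (euclidsLemma; prime⇒irreducible; prime⇒nonTrivial; prime⇒nonZero)
open import Data.Nat.Tactic.RingSolver using () renaming (solve-∀ to ℕ-solve-∀)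
open import Data.Product using (_,_; ∃; proj₁; proj₂)
open import Data.Sum using (inj₁; inj₂)
open import Function.Bundles using (mk⇔)
open import Level using (0ℓ)
open import Relation.Binary using (tri<; tri≈; tri>)
import Relation.Binary.Reasoning.Setoid as SetoidReasoning
open import Relation.Binary.PropositionalEquality
  using (refl; sym; trans; cong; cong₂; subst; module ≡-Reasoning)
open import Relation.Nullary using (yes; no)
open import Relation.Nullary.Decidable using (⌊_⌋)

-- Formal power series over ℤ

-- `Ψ` is computed by long division from the recursive table of cyclotomic polynomials, and long
-- division discards its remainder. So Φ_n is identified only once the division is known to be
-- exact, that is, once a polynomial H is in hand whose product with all Φ_d, d a proper divisor of
-- n, is x^n - 1. Lists are read as power series, where x^n - 1 can be cancelled and identities
-- between quotients are checked by multiplying out. But there a factor with constant term ±1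
-- divides everything, so that H is a polynomial must be proved separately. For n = pq the
-- difference of two grids is such an H; for n = pqr it comes from a Bézout identity.
--
-- The inequality is a degree condition: p - 1 degrees in steps of r span (p - 2) r, at most deg
-- Φ_pq, and equality fails since the prime r exceeds p - 1 and q - 1. Conversely, the congruences
-- give r = q + p h, and the multiples r j = p (h j) + q j walk diagonally through the grid; the
-- inequality keeps the last column h (p - 2) inside.

Series : Set
Series = ℕ → ℤ

infix 4 _≐_
-- A record rather than a bare family of equations, so that unification can recover both series from
-- the type.
record _≐_ (f g : Series) : Set where
  constructor pointwise
  field coeff : ∀ n → f n ≡ g n
open _≐_

tail : Series → Series
tail f n = f (suc n)

const : ℤ → Series
const c zero = c
const c (suc n) = + 0

𝟘 𝟙 : Series
𝟘 n = + 0
𝟙 = const (+ 1)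

infixl 6 _⊕_
infixl 7 _⋆_
infix 8 ⊖_

-- The product splits off the constant term of the left factor, f = f 0 + x `tail f`; the ring laws
-- then go by induction on the degree, without sums over i + j = n.
_⊕_ _⋆_ : Series → Series → Series
(f ⊕ g) n = f n ℤ.+ g n
(f ⋆ g) zero = f 0 ℤ.* g 0
(f ⋆ g) (suc n) = f 0 ℤ.* g (suc n) ℤ.+ (tail f ⋆ g) n

⊖_ : Series → Series
(⊖ f) n = ℤ.- f n

≐-refl : ∀ {f} → f ≐ f
≐-refl = pointwise λ _ → refl

≐-sym : ∀ {f g} → f ≐ g → g ≐ f
≐-sym e = pointwise λ n → sym (coeff e n)

≐-trans : ∀ {f g h} → f ≐ g → g ≐ h → f ≐ h
≐-trans d e = pointwise λ n → trans (coeff d n) (coeff e n)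

⋆-cong-at : ∀ n {f f′ g g′} → f ≐ f′ → g ≐ g′ → (f ⋆ g) n ≡ (f′ ⋆ g′) n
⋆-cong-at zero d e = cong₂ ℤ._*_ (coeff d 0) (coeff e 0)
⋆-cong-at (suc n) d e = cong₂ ℤ._+_ (cong₂ ℤ._*_ (coeff d 0) (coeff e (suc n)))
  (⋆-cong-at n (pointwise λ i → coeff d (suc i)) e)

⋆-cong : ∀ {f f′ g g′} → f ≐ f′ → g ≐ g′ → f ⋆ g ≐ f′ ⋆ g′
⋆-cong d e = pointwise λ n → ⋆-cong-at n d e

-- The mirror image of the defining recursion, splitting off the constant term of the right factor;
-- commutativity compares the two.
⋆-suc′ : ∀ n f g → (f ⋆ g) (suc n) ≡ f (suc n) ℤ.* g 0 ℤ.+ (f ⋆ tail g) n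
⋆-suc′ zero f g = ℤₚ.+-comm (f 0 ℤ.* g 1) (f 1 ℤ.* g 0)
⋆-suc′ (suc n) f g = trans
  (cong (λ z → f 0 ℤ.* g (suc (suc n)) ℤ.+ z) (⋆-suc′ n (tail f) g))
  (swap (f 0 ℤ.* g (suc (suc n))) (f (suc (suc n)) ℤ.* g 0) ((tail f ⋆ tail g) n))
  where
  swap : ∀ a b c → a ℤ.+ (b ℤ.+ c) ≡ b ℤ.+ (a ℤ.+ c)
  swap = ℤ-solve-∀

⋆-comm-at : ∀ n f g → (f ⋆ g) n ≡ (g ⋆ f) n
⋆-comm-at zero f g = ℤₚ.*-comm (f 0) (g 0)
⋆-comm-at (suc n) f g = trans
  (cong₂ ℤ._+_ (ℤₚ.*-comm (f 0) (g (suc n))) (⋆-comm-at n (tail f) g))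
  (sym (⋆-suc′ n g f))

⋆-comm : ∀ f g → f ⋆ g ≐ g ⋆ f
⋆-comm f g = pointwise λ n → ⋆-comm-at n f g

⋆-distribʳ-at : ∀ n f g h → ((f ⊕ g) ⋆ h) n ≡ (f ⋆ h) n ℤ.+ (g ⋆ h) n
⋆-distribʳ-at zero f g h = ℤₚ.*-distribʳ-+ (h 0) (f 0) (g 0)
⋆-distribʳ-at (suc n) f g h = trans
  (cong (λ z → (f 0 ℤ.+ g 0) ℤ.* h (suc n) ℤ.+ z) (⋆-distribʳ-at n (tail f) (tail g) h))
  (rearrange (f 0) (g 0) (h (suc n)) ((tail f ⋆ h) n) ((tail g ⋆ h) n))
  where
  rearrange : ∀ a b c d e → (a ℤ.+ b) ℤ.* c ℤ.+ (d ℤ.+ e) ≡ (a ℤ.* c ℤ.+ d) ℤ.+ (b ℤ.* c ℤ.+ e)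
  rearrange = ℤ-solve-∀

⋆-distribʳ : ∀ h f g → (f ⊕ g) ⋆ h ≐ f ⋆ h ⊕ g ⋆ h
⋆-distribʳ h f g = pointwise λ n → ⋆-distribʳ-at n f g h

scale-⋆ : ∀ n c f g → ((λ i → c ℤ.* f i) ⋆ g) n ≡ c ℤ.* (f ⋆ g) n
scale-⋆ zero c f g = ℤₚ.*-assoc c (f 0) (g 0)
scale-⋆ (suc n) c f g = trans
  (cong (λ z → c ℤ.* f 0 ℤ.* g (suc n) ℤ.+ z) (scale-⋆ n c (tail f) g))
  (factor c (f 0) (g (suc n)) ((tail f ⋆ g) n))
  where
  factor : ∀ c a b d → c ℤ.* a ℤ.* b ℤ.+ c ℤ.* d ≡ c ℤ.* (a ℤ.* b ℤ.+ d)
  factor = ℤ-solve-∀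

-- By definition `tail (f ⋆ g)` is f 0 times `tail g` plus `tail f ⋆ g`, so distributivity and
-- scaling lead back to the induction hypothesis.
⋆-assoc-at : ∀ n f g h → ((f ⋆ g) ⋆ h) n ≡ (f ⋆ (g ⋆ h)) n
⋆-assoc-at zero f g h = ℤₚ.*-assoc (f 0) (g 0) (h 0)
⋆-assoc-at (suc n) f g h = begin
  f 0 ℤ.* g 0 ℤ.* h (suc n) ℤ.+ (tail (f ⋆ g) ⋆ h) n
    ≡⟨ cong (λ z → f 0 ℤ.* g 0 ℤ.* h (suc n) ℤ.+ z)
         (⋆-distribʳ-at n (λ i → f 0 ℤ.* g (suc i)) (tail f ⋆ g) h) ⟩
  f 0 ℤ.* g 0 ℤ.* h (suc n) ℤ.+ (((λ i → f 0 ℤ.* g (suc i)) ⋆ h) n ℤ.+ ((tail f ⋆ g) ⋆ h) n)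
    ≡⟨ cong (λ z → f 0 ℤ.* g 0 ℤ.* h (suc n) ℤ.+ z)
         (cong₂ ℤ._+_ (scale-⋆ n (f 0) (tail g) h) (⋆-assoc-at n (tail f) g h)) ⟩
  f 0 ℤ.* g 0 ℤ.* h (suc n) ℤ.+ (f 0 ℤ.* (tail g ⋆ h) n ℤ.+ (tail f ⋆ (g ⋆ h)) n)
    ≡⟨ factor (f 0) (g 0) (h (suc n)) ((tail g ⋆ h) n) ((tail f ⋆ (g ⋆ h)) n) ⟩
  f 0 ℤ.* (g 0 ℤ.* h (suc n) ℤ.+ (tail g ⋆ h) n) ℤ.+ (tail f ⋆ (g ⋆ h)) n ∎
  where
  open ≡-Reasoning
  factor : ∀ a b c d e → a ℤ.* b ℤ.* c ℤ.+ (a ℤ.* d ℤ.+ e) ≡ a ℤ.* (b ℤ.* c ℤ.+ d) ℤ.+ e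
  factor = ℤ-solve-∀

⋆-assoc : ∀ f g h → (f ⋆ g) ⋆ h ≐ f ⋆ (g ⋆ h)
⋆-assoc f g h = pointwise λ n → ⋆-assoc-at n f g h

𝟘⋆-at : ∀ n f → (𝟘 ⋆ f) n ≡ + 0
𝟘⋆-at zero f = ℤₚ.*-zeroˡ (f 0)
𝟘⋆-at (suc n) f = cong₂ ℤ._+_ (ℤₚ.*-zeroˡ (f (suc n))) (𝟘⋆-at n f)

const⋆-at : ∀ c n f → (const c ⋆ f) n ≡ c ℤ.* f n
const⋆-at c zero f = refl
const⋆-at c (suc n) f = trans (cong (λ z → c ℤ.* f (suc n) ℤ.+ z) (𝟘⋆-at n f)) (ℤₚ.+-identityʳ _)

⊕-cong : ∀ {f f′ g g′} → f ≐ f′ → g ≐ g′ → f ⊕ g ≐ f′ ⊕ g′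
⊕-cong d e = pointwise λ n → cong₂ ℤ._+_ (coeff d n) (coeff e n)

⋆-identityˡ : ∀ f → 𝟙 ⋆ f ≐ f
⋆-identityˡ f = pointwise λ n → trans (const⋆-at (+ 1) n f) (ℤₚ.*-identityˡ (f n))

seriesRing : CommutativeRing 0ℓ 0ℓ
seriesRing = record
  { Carrier = Series ; _≈_ = _≐_ ; _+_ = _⊕_ ; _*_ = _⋆_ ; -_ = ⊖_ ; 0# = 𝟘 ; 1# = 𝟙
  ; isCommutativeRing = record
    { isRing = record
      { +-isAbelianGroup = record
        { isGroup = record
          { isMonoid = record
            { isSemigroup = record
              { isMagma = record
                { isEquivalence = record { refl = ≐-refl ; sym = ≐-sym ; trans = ≐-trans }
                ; ∙-cong = ⊕-cong }
              ; assoc = λ f g h → pointwise λ n → ℤₚ.+-assoc (f n) (g n) (h n) }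
            ; identity = (λ f → pointwise λ n → ℤₚ.+-identityˡ (f n))
                       , (λ f → pointwise λ n → ℤₚ.+-identityʳ (f n)) }
          ; inverse = (λ f → pointwise λ n → ℤₚ.+-inverseˡ (f n))
                    , (λ f → pointwise λ n → ℤₚ.+-inverseʳ (f n))
          ; ⁻¹-cong = λ e → pointwise λ n → cong ℤ.-_ (coeff e n) }
        ; comm = λ f g → pointwise λ n → ℤₚ.+-comm (f n) (g n) }
      ; *-cong = ⋆-cong
      ; *-assoc = ⋆-assoc
      ; *-identity = ⋆-identityˡ , (λ f → ≐-trans (⋆-comm f 𝟙) (⋆-identityˡ f))
      ; distrib = (λ h f g → ≐-trans (⋆-comm h (f ⊕ g)) (≐-trans (⋆-distribʳ h f g)
                    (⊕-cong (⋆-comm f h) (⋆-comm g h))))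
                , ⋆-distribʳ }
    ; *-comm = ⋆-comm } }

open CommutativeRing seriesRing using () renaming (setoid to seriesSetoid)

-- Integers serve as the coefficients of the ring solver: `con (+ 1)` then means `𝟙`, and x^n - 1
-- can be written inside solver expressions.
constHom : CommutativeRing.rawRing ℤₚ.+-*-commutativeRing
           ACR.-Raw-AlmostCommutative⟶ ACR.fromCommutativeRing seriesRing
constHom = record
  { ⟦_⟧ = const
  ; +-homo = λ a b → pointwise λ { zero → refl ; (suc n) → refl }
  ; *-homo = λ a b → pointwise λ
      { zero → refl
      ; (suc n) → sym (trans (const⋆-at a (suc n) (const b)) (ℤₚ.*-zeroʳ a)) }
  ; -‿homo = λ a → pointwise λ { zero → refl ; (suc n) → refl }
  ; 0-homo = pointwise λ { zero → refl ; (suc n) → refl }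
  ; 1-homo = ≐-refl }

const≟ : (a b : ℤ) → Maybe (const a ≐ const b)
const≟ a b with a ℤ.≟ b
... | yes refl = just ≐-refl
... | no _ = nothing

open RingSolver (CommutativeRing.rawRing ℤₚ.+-*-commutativeRing)
  (ACR.fromCommutativeRing seriesRing) constHom const≟
  using (solve; _:=_; _:+_; _:*_; _:-_; :-_; con)

-- Monomials, degree bounds and cancellation of monic factors

X : ℕ → Series
X zero = 𝟙
X (suc n) zero = + 0
X (suc n) (suc k) = X n k

X⋆-+ : ∀ n f k → (X n ⋆ f) (n + k) ≡ f k
X⋆-+ zero f k = coeff (⋆-identityˡ f) k
X⋆-+ (suc n) f k = trans
  (cong₂ ℤ._+_ (ℤₚ.*-zeroˡ (f (suc (n + k)))) (X⋆-+ n f k)) (ℤₚ.+-identityˡ _)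

X⋆-< : ∀ n f {k} → k < n → (X n ⋆ f) k ≡ + 0
X⋆-< (suc n) f {zero} _ = ℤₚ.*-zeroˡ (f 0)
X⋆-< (suc n) f {suc k} (s≤s k<n) =
  cong₂ ℤ._+_ (ℤₚ.*-zeroˡ (f (suc k))) (X⋆-< n f k<n)

X-+ : ∀ m n → X m ⋆ X n ≐ X (m + n)
X-+ zero n = ⋆-identityˡ (X n)
X-+ (suc m) n = pointwise λ
  { zero → ℤₚ.*-zeroˡ (X n 0)
  ; (suc k) → trans (cong₂ ℤ._+_ (ℤₚ.*-zeroˡ (X n (suc k))) (coeff (X-+ m n) k))
                    (ℤₚ.+-identityˡ _) }

Vanish : Series → ℕ → Set
Vanish f n = ∀ k → n ≤ k → f k ≡ + 0

-- Degree below a plus degree at most b stays below a + b; bounding the factors in these two ways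
-- avoids subtraction.
vanish-⋆ : ∀ a {b f g} → Vanish f a → Vanish g (suc b) → Vanish (f ⋆ g) (a + b)
vanish-⋆ zero {g = g} f0 g0 k _ =
  trans (⋆-cong-at k (pointwise λ i → f0 i z≤n) ≐-refl) (𝟘⋆-at k g)
vanish-⋆ (suc a) {b} {f} {g} f0 g0 (suc k) (s≤s h) = cong₂ ℤ._+_
  (trans (cong (f 0 ℤ.*_) (g0 (suc k) (s≤s (ℕₚ.≤-trans (ℕₚ.m≤n+m b a) h)))) (ℤₚ.*-zeroʳ (f 0)))
  (vanish-⋆ a (λ i a≤i → f0 (suc i) (s≤s a≤i)) g0 k h)

top-⋆ : ∀ a b {f g} → Vanish f (suc a) → Vanish g (suc b) → (f ⋆ g) (a + b) ≡ f a ℤ.* g b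
top-⋆ zero b {f} {g} f0 g0 = trans
  (⋆-cong-at b (pointwise λ { zero → refl ; (suc n) → f0 (suc n) (s≤s z≤n) }) ≐-refl)
  (const⋆-at (f 0) b g)
top-⋆ (suc a) b {f} {g} f0 g0 = trans
  (cong₂ ℤ._+_
    (trans (cong (f 0 ℤ.*_) (g0 (suc (a + b)) (s≤s (ℕₚ.m≤n+m b a)))) (ℤₚ.*-zeroʳ (f 0)))
    (top-⋆ a b (λ i a≤i → f0 (suc i) (s≤s a≤i)) g0))
  (ℤₚ.+-identityˡ _)

-- A coefficient of D in the top degree N reappears in degree a + N of the product, since G is
-- monic; descent on N then clears D. Only degrees from a upward enter, because a division by G
-- leaves a remainder below a.
monic-cancel : ∀ {a G} → Vanish G (suc a) → G a ≡ + 1 →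
  ∀ N {D} → Vanish D N → Vanish (G ⋆ D) a → D ≐ 𝟘
monic-cancel G0 Ga zero D0 _ = pointwise λ i → D0 i z≤n
monic-cancel {a} {G} G0 Ga (suc N) {D} D0 GD0 = monic-cancel G0 Ga N D0′ GD0
  where
  DN≡0 : D N ≡ + 0
  DN≡0 = trans (sym (trans (cong (ℤ._* D N) Ga) (ℤₚ.*-identityˡ (D N))))
    (trans (sym (top-⋆ a N G0 D0)) (GD0 (a + N) (ℕₚ.m≤m+n a N)))
  D0′ : Vanish D N
  D0′ k N≤k with ℕₚ.m≤n⇒m<n∨m≡n N≤k
  ... | inj₁ N<k = D0 k N<k
  ... | inj₂ refl = DN≡0

⋆-local : ∀ n f {g g′} → (∀ i → i ≤ n → g i ≡ g′ i) → (f ⋆ g) n ≡ (f ⋆ g′) n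
⋆-local zero f e = cong (f 0 ℤ.*_) (e 0 z≤n)
⋆-local (suc n) f e = cong₂ ℤ._+_ (cong (f 0 ℤ.*_) (e (suc n) ℕₚ.≤-refl))
  (⋆-local n (tail f) λ i i≤n → e i (ℕₚ.m≤n⇒m≤1+n i≤n))

sumℤ-cong : ∀ n {f g} → (∀ i → i < n → f i ≡ g i) → sumℤ n f ≡ sumℤ n g
sumℤ-cong zero e = refl
sumℤ-cong (suc n) e = cong₂ ℤ._+_ (sumℤ-cong n λ i i<n → e i (ℕₚ.m≤n⇒m≤1+n i<n)) (e n ℕₚ.≤-refl)

sumℤ-+ : ∀ m n f → sumℤ (m + n) f ≡ sumℤ m f ℤ.+ sumℤ n (λ i → f (m + i))
sumℤ-+ m zero f = trans (cong (λ k → sumℤ k f) (ℕₚ.+-identityʳ m)) (sym (ℤₚ.+-identityʳ _))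
sumℤ-+ m (suc n) f = trans (cong (λ k → sumℤ k f) (ℕₚ.+-suc m n))
  (trans (cong (ℤ._+ f (m + n)) (sumℤ-+ m n f)) (ℤₚ.+-assoc (sumℤ m f) _ _))

-- The shape in which `divMonic` computes the next coefficient of a quotient.
⋆-sum : ∀ n f g → (f ⋆ g) n ≡ f 0 ℤ.* g n ℤ.+ sumℤ n (λ j → f (suc j) ℤ.* g (n ∸ suc j))
⋆-sum zero f g = sym (ℤₚ.+-identityʳ _)
⋆-sum (suc n) f g = cong (λ z → f 0 ℤ.* g (suc n) ℤ.+ z) (trans (⋆-sum n (tail f) g)
  (sym (trans (sumℤ-+ 1 n _)
    (cong (ℤ._+ sumℤ n (λ j → f (suc (suc j)) ℤ.* g (n ∸ suc j))) (ℤₚ.+-identityˡ (f 1 ℤ.* g n))))))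

-- Coefficient lists as series

⟦_⟧ : Poly → Series
⟦ f ⟧ = at (+ 0) f

⟦⟧-vanish : ∀ f → Vanish ⟦ f ⟧ (length f)
⟦⟧-vanish [] k _ = refl
⟦⟧-vanish (a ∷ f) (suc k) (s≤s h) = ⟦⟧-vanish f k h

⟦+ₚ⟧ : ∀ f g n → ⟦ f +ₚ g ⟧ n ≡ ⟦ f ⟧ n ℤ.+ ⟦ g ⟧ n
⟦+ₚ⟧ [] g n = sym (ℤₚ.+-identityˡ _)
⟦+ₚ⟧ (a ∷ f) [] n = sym (ℤₚ.+-identityʳ _)
⟦+ₚ⟧ (a ∷ f) (b ∷ g) zero = refl
⟦+ₚ⟧ (a ∷ f) (b ∷ g) (suc n) = ⟦+ₚ⟧ f g n

⟦map*⟧ : ∀ a f n → ⟦ map (a ℤ.*_) f ⟧ n ≡ a ℤ.* ⟦ f ⟧ n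
⟦map*⟧ a [] n = sym (ℤₚ.*-zeroʳ a)
⟦map*⟧ a (b ∷ f) zero = refl
⟦map*⟧ a (b ∷ f) (suc n) = ⟦map*⟧ a f n

⟦shift⟧-zero : ∀ f → ⟦ shift f ⟧ 0 ≡ + 0
⟦shift⟧-zero [] = refl
⟦shift⟧-zero (_ ∷ _) = refl

⟦shift⟧-suc : ∀ f n → ⟦ shift f ⟧ (suc n) ≡ ⟦ f ⟧ n
⟦shift⟧-suc [] n = refl
⟦shift⟧-suc (_ ∷ _) n = refl

⟦*ₚ⟧-at : ∀ f g n → ⟦ f *ₚ g ⟧ n ≡ (⟦ f ⟧ ⋆ ⟦ g ⟧) n
⟦*ₚ⟧-at [] g n = sym (𝟘⋆-at n ⟦ g ⟧)
⟦*ₚ⟧-at (a ∷ f) g zero = trans (⟦+ₚ⟧ (map (a ℤ.*_) g) (shift (f *ₚ g)) 0)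
  (trans (cong₂ ℤ._+_ (⟦map*⟧ a g 0) (⟦shift⟧-zero (f *ₚ g))) (ℤₚ.+-identityʳ _))
⟦*ₚ⟧-at (a ∷ f) g (suc n) = trans (⟦+ₚ⟧ (map (a ℤ.*_) g) (shift (f *ₚ g)) (suc n))
  (cong₂ ℤ._+_ (⟦map*⟧ a g (suc n)) (trans (⟦shift⟧-suc (f *ₚ g) n) (⟦*ₚ⟧-at f g n)))

⟦*ₚ⟧ : ∀ f g → ⟦ f *ₚ g ⟧ ≐ ⟦ f ⟧ ⋆ ⟦ g ⟧
⟦*ₚ⟧ f g = pointwise (⟦*ₚ⟧-at f g)

⟦[]⟧ : ∀ a → ⟦ [ a ] ⟧ ≐ const a
⟦[]⟧ a = pointwise λ { zero → refl ; (suc n) → refl }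

⟦++⟧ : ∀ f g → ⟦ f ++ g ⟧ ≐ ⟦ f ⟧ ⊕ X (length f) ⋆ ⟦ g ⟧
⟦++⟧ [] g = ≐-sym (≐-trans (pointwise λ n → ℤₚ.+-identityˡ _) (⋆-identityˡ ⟦ g ⟧))
⟦++⟧ (a ∷ f) g = pointwise λ
  { zero → sym (trans (cong (λ z → a ℤ.+ z) (ℤₚ.*-zeroˡ (⟦ g ⟧ 0))) (ℤₚ.+-identityʳ a))
  ; (suc n) → trans (coeff (⟦++⟧ f g) n) (cong (λ z → ⟦ f ⟧ n ℤ.+ z)
      (sym (trans (cong (ℤ._+ (X (length f) ⋆ ⟦ g ⟧) n) (ℤₚ.*-zeroˡ (⟦ g ⟧ (suc n)))) (ℤₚ.+-identityˡ _)))) }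

⟦++⟧-< : ∀ f g {n} → n < length f → ⟦ f ++ g ⟧ n ≡ ⟦ f ⟧ n
⟦++⟧-< f g {n} h = trans (coeff (⟦++⟧ f g) n)
  (trans (cong (λ z → ⟦ f ⟧ n ℤ.+ z) (X⋆-< (length f) ⟦ g ⟧ h)) (ℤₚ.+-identityʳ _))

⟦++⟧-+ : ∀ f g k → ⟦ f ++ g ⟧ (length f + k) ≡ ⟦ g ⟧ k
⟦++⟧-+ f g k = trans (coeff (⟦++⟧ f g) (length f + k)) (trans
  (cong₂ ℤ._+_ (⟦⟧-vanish f (length f + k) (ℕₚ.m≤m+n (length f) k)) (X⋆-+ (length f) ⟦ g ⟧ k))
  (ℤₚ.+-identityˡ _))

⟦reverse⟧ : ∀ f i j → suc (i + j) ≡ length f → ⟦ reverse f ⟧ i ≡ ⟦ f ⟧ j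
⟦reverse⟧ (a ∷ f) i j e rewrite Listₚ.unfold-reverse a f with j
... | zero = trans (cong ⟦ reverse f ++ [ a ] ⟧ i≡) (⟦++⟧-+ (reverse f) [ a ] 0)
  where
  i≡ : i ≡ length (reverse f) + 0
  i≡ = trans (sym (ℕₚ.+-identityʳ i)) (trans (ℕₚ.suc-injective e)
    (sym (trans (ℕₚ.+-identityʳ _) (Listₚ.length-reverse f))))
... | suc j = trans (⟦++⟧-< (reverse f) [ a ]
    (subst (i <_) (trans e′ (sym (Listₚ.length-reverse f))) (s≤s (ℕₚ.m≤m+n i j))))
  (⟦reverse⟧ f i j e′)
  where
  e′ : suc (i + j) ≡ length f
  e′ = trans (sym (ℕₚ.+-suc i j)) (ℕₚ.suc-injective e)

-- Substituting 1/x for x respects products, and i and j are complementary degrees of the product.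
-- The first entry of f becomes the last of its reversal and contributes one shifted copy of
-- `reverse g`.
reverse-⋆ : ∀ f g i j {b} → length g ≡ suc b → suc (suc (i + j)) ≡ length f + length g →
  (⟦ reverse f ⟧ ⋆ ⟦ reverse g ⟧) i ≡ (⟦ f ⟧ ⋆ ⟦ g ⟧) j
reverse-⋆ [] g i j _ _ = trans (𝟘⋆-at i _) (sym (𝟘⋆-at j _))
reverse-⋆ (a ∷ f) g i j {b} |g| e = begin
  (⟦ reverse (a ∷ f) ⟧ ⋆ rg) i
    ≡⟨ ⋆-cong-at i (≐-trans (pointwise λ n → cong (λ z → ⟦ z ⟧ n) (Listₚ.unfold-reverse a f))
         (⟦++⟧ (reverse f) [ a ])) ≐-refl ⟩
  ((⟦ reverse f ⟧ ⊕ X |f| ⋆ ⟦ [ a ] ⟧) ⋆ rg) i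
    ≡⟨ ⋆-distribʳ-at i ⟦ reverse f ⟧ (X |f| ⋆ ⟦ [ a ] ⟧) rg ⟩
  (⟦ reverse f ⟧ ⋆ rg) i ℤ.+ ((X |f| ⋆ ⟦ [ a ] ⟧) ⋆ rg) i
    ≡⟨ cong (λ z → (⟦ reverse f ⟧ ⋆ rg) i ℤ.+ z)
         (trans (⋆-assoc-at i (X |f|) ⟦ [ a ] ⟧ rg) last-row) ⟩
  (⟦ reverse f ⟧ ⋆ rg) i ℤ.+ a ℤ.* ⟦ g ⟧ j
    ≡⟨ rest j e ⟩
  (⟦ a ∷ f ⟧ ⋆ ⟦ g ⟧) j ∎
  where
  open ≡-Reasoning
  rg = ⟦ reverse g ⟧
  |f| = length (reverse f)
  e₁ : suc (i + j) ≡ |f| + length g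
  e₁ = trans (ℕₚ.suc-injective e) (cong (_+ length g) (sym (Listₚ.length-reverse f)))
  last-row : (X |f| ⋆ (⟦ [ a ] ⟧ ⋆ rg)) i ≡ a ℤ.* ⟦ g ⟧ j
  last-row with |f| ≤? i
  ... | yes h = trans (cong (X |f| ⋆ (⟦ [ a ] ⟧ ⋆ rg)) (sym (ℕₚ.m+[n∸m]≡n h)))
    (trans (X⋆-+ |f| _ (i ∸ |f|)) (trans (⋆-cong-at (i ∸ |f|) (⟦[]⟧ a) ≐-refl)
    (trans (const⋆-at a (i ∸ |f|) rg) (cong (a ℤ.*_) (⟦reverse⟧ g (i ∸ |f|) j
      (ℕₚ.+-cancelˡ-≡ |f| _ _ (trans (ℕₚ.+-suc |f| _) (trans (cong suc
        (trans (sym (ℕₚ.+-assoc |f| (i ∸ |f|) j)) (cong (_+ j) (ℕₚ.m+[n∸m]≡n h)))) e₁))))))))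
  ... | no h = trans (X⋆-< |f| _ i<) (sym (trans (cong (a ℤ.*_) (⟦⟧-vanish g j |g|≤j)) (ℤₚ.*-zeroʳ a)))
    where
    i< : i < |f|
    i< = ℕₚ.≰⇒> h
    |g|≤j : length g ≤ j
    |g|≤j = ℕₚ.+-cancelˡ-≤ |f| _ _ (ℕₚ.≤-trans (ℕₚ.≤-reflexive (sym e₁)) (ℕₚ.+-monoˡ-≤ j i<))
  rest : ∀ j → suc (suc (i + j)) ≡ suc (length f) + length g →
    (⟦ reverse f ⟧ ⋆ rg) i ℤ.+ a ℤ.* ⟦ g ⟧ j ≡ (⟦ a ∷ f ⟧ ⋆ ⟦ g ⟧) j
  rest zero e = trans (cong (ℤ._+ _) (vanish-⋆ |f| (⟦⟧-vanish (reverse f))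
      (subst (Vanish rg) (trans (Listₚ.length-reverse g) |g|) (⟦⟧-vanish (reverse g)))
      i (ℕₚ.≤-reflexive |f|+b≡i)))
    (ℤₚ.+-identityˡ _)
    where
    |f|+b≡i : |f| + b ≡ i
    |f|+b≡i = ℕₚ.suc-injective (trans (sym (ℕₚ.+-suc |f| b)) (trans
      (cong₂ _+_ (Listₚ.length-reverse f) (sym |g|))
      (trans (sym (ℕₚ.suc-injective e)) (cong suc (ℕₚ.+-identityʳ i)))))
  rest (suc j) e = trans (ℤₚ.+-comm ((⟦ reverse f ⟧ ⋆ rg) i) (a ℤ.* ⟦ g ⟧ (suc j))) (cong (λ z → a ℤ.* ⟦ g ⟧ (suc j) ℤ.+ z)
    (reverse-⋆ f g i j |g| (trans (cong suc (sym (ℕₚ.+-suc i j))) (ℕₚ.suc-injective e))))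

-- Division by a monic list

next : Poly → Poly → List ℤ → ℤ
next F G acc = ⟦ F ⟧ i ℤ.- sumℤ i (λ j → ⟦ G ⟧ (suc j) ℤ.* ⟦ acc ⟧ (i ∸ suc j))
  where i = length acc

quotientLoop : Poly → Poly → ℕ → List ℤ → List ℤ
quotientLoop F G zero acc = acc
quotientLoop F G (suc k) acc = quotientLoop F G k (acc ++ [ next F G acc ])

reversedQuotient : Poly → Poly → List ℤ
reversedQuotient F G =
  quotientLoop (reverse F) (reverse G) (suc (length (reverse F) ∸ length (reverse G))) []

-- The loop of divMonic is local to its where-block and cannot be named: its occurrence in the
-- goal of the first lemma determines the left-hand side of the second.
mutual
  divMonic-reverse : ∀ F G → divMonic F G ≡ reverse (reversedQuotient F G)
  divMonic-reverse F G with length (reverse F) ∸ length (reverse G) | next (reverse F) (reverse G) []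
  ... | n | z with [ z ]
  ... | acc = loop≡quotientLoop F G n acc

  loop≡quotientLoop : ∀ F G k acc → _ ≡ reverse (quotientLoop (reverse F) (reverse G) k acc)
  loop≡quotientLoop F G zero acc = refl
  loop≡quotientLoop F G (suc k) acc = loop≡quotientLoop F G k _

quotientLoop-length : ∀ F G k acc → length (quotientLoop F G k acc) ≡ length acc + k
quotientLoop-length F G zero acc = sym (ℕₚ.+-identityʳ _)
quotientLoop-length F G (suc k) acc = trans (quotientLoop-length F G k _)
  (trans (cong (_+ k) (trans (Listₚ.length-++ acc) (ℕₚ.+-comm _ 1))) (sym (ℕₚ.+-suc _ k)))

-- Read leading coefficient first, long division is power series division: the accumulator is the
-- truncated quotient, and as G starts with 1, each new degree determines exactly one new
-- coefficient.
quotientLoop-correct : ∀ F G → ⟦ G ⟧ 0 ≡ + 1 → ∀ k acc →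
  (∀ i → i < length acc → (⟦ G ⟧ ⋆ ⟦ acc ⟧) i ≡ ⟦ F ⟧ i) →
  ∀ i → i < length (quotientLoop F G k acc) → (⟦ G ⟧ ⋆ ⟦ quotientLoop F G k acc ⟧) i ≡ ⟦ F ⟧ i
quotientLoop-correct F G G0 zero acc inv = inv
quotientLoop-correct F G G0 (suc k) acc inv = quotientLoop-correct F G G0 k acc⁺ inv⁺
  where
  acc⁺ = acc ++ [ next F G acc ]
  n = length acc
  tailSum = sumℤ n (λ j → ⟦ G ⟧ (suc j) ℤ.* ⟦ acc ⟧ (n ∸ suc j))
  last : ⟦ acc⁺ ⟧ n ≡ next F G acc
  last = trans (cong ⟦ acc⁺ ⟧ (sym (ℕₚ.+-identityʳ n))) (⟦++⟧-+ acc _ 0)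
  n∸suc< : ∀ {j} → j < n → n ∸ suc j < n
  n∸suc< {j} j<n = ℕₚ.∸-monoʳ-< {n} {suc j} {0} (s≤s z≤n) j<n
  inv⁺ : ∀ i → i < length acc⁺ → (⟦ G ⟧ ⋆ ⟦ acc⁺ ⟧) i ≡ ⟦ F ⟧ i
  inv⁺ i i< with ℕₚ.m≤n⇒m<n∨m≡n
    (ℕₚ.≤-pred (subst (i <_) (trans (Listₚ.length-++ acc) (ℕₚ.+-comm _ 1)) i<))
  ... | inj₁ i<n = trans
    (⋆-local i ⟦ G ⟧ λ j j≤i → ⟦++⟧-< acc _ (ℕₚ.≤-<-trans j≤i i<n)) (inv i i<n)
  ... | inj₂ refl = begin
    (⟦ G ⟧ ⋆ ⟦ acc⁺ ⟧) n
      ≡⟨ ⋆-sum n ⟦ G ⟧ ⟦ acc⁺ ⟧ ⟩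
    ⟦ G ⟧ 0 ℤ.* ⟦ acc⁺ ⟧ n ℤ.+ sumℤ n (λ j → ⟦ G ⟧ (suc j) ℤ.* ⟦ acc⁺ ⟧ (n ∸ suc j))
      ≡⟨ cong₂ ℤ._+_ (trans (cong₂ ℤ._*_ G0 last) (ℤₚ.*-identityˡ _))
           (sumℤ-cong n λ j j<n → cong (⟦ G ⟧ (suc j) ℤ.*_) (⟦++⟧-< acc _ (n∸suc< j<n))) ⟩
    (⟦ F ⟧ n ℤ.- tailSum) ℤ.+ tailSum
      ≡⟨ minus-plus (⟦ F ⟧ n) tailSum ⟩
    ⟦ F ⟧ n ∎
    where
    open ≡-Reasoning
    minus-plus : ∀ a b → (a ℤ.- b) ℤ.+ b ≡ a
    minus-plus = ℤ-solve-∀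

-- The length is fixed along with the leading coefficient: trailing zeros are excluded, so the
-- reversed list starts with 1, as the division loop expects.
record Monic (f : Poly) : Set where
  constructor monic
  field
    {degree} : ℕ
    length≡ : length f ≡ suc degree
    lead≡1 : ⟦ f ⟧ degree ≡ + 1

  vanish : Vanish ⟦ f ⟧ (suc degree)
  vanish = subst (Vanish ⟦ f ⟧) length≡ (⟦⟧-vanish f)
open Monic

reverse-lead : ∀ {f} → Monic f → ⟦ reverse f ⟧ 0 ≡ + 1
reverse-lead {f} (monic {d} l t) = trans (⟦reverse⟧ f 0 d (sym l)) t

module Division {F G} (mF : Monic F) (mG : Monic G) where

  private
    f = degree mF
    g = degree mG
    Q = divMonic F G
    L = reversedQuotient F G

  length-L : length L ≡ suc (f ∸ g)
  length-L = trans (quotientLoop-length (reverse F) (reverse G) _ []) (cong suc (cong₂ _∸_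
    (trans (Listₚ.length-reverse F) (length≡ mF)) (trans (Listₚ.length-reverse G) (length≡ mG))))

  L-correct : ∀ i → i ≤ f ∸ g → (⟦ reverse G ⟧ ⋆ ⟦ L ⟧) i ≡ ⟦ reverse F ⟧ i
  L-correct i i≤ = quotientLoop-correct (reverse F) (reverse G) (reverse-lead mG)
    (suc (length (reverse F) ∸ length (reverse G))) [] (λ _ ()) i
    (subst (i <_) (sym length-L) (s≤s i≤))

  length-Q : length Q ≡ suc (f ∸ g)
  length-Q = trans (cong length (divMonic-reverse F G)) (trans (Listₚ.length-reverse L) length-L)

  -- The first coefficient computed is the quotient of the leading ones. Exactness does not enter,
  -- so all table entries are monic before any of them is identified.
  divMonic-monic : Monic (divMonic F G)
  divMonic-monic = monic length-Q (begin
    ⟦ Q ⟧ (f ∸ g)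
      ≡⟨ cong (λ z → ⟦ z ⟧ (f ∸ g)) (divMonic-reverse F G) ⟩
    ⟦ reverse L ⟧ (f ∸ g)
      ≡⟨ ⟦reverse⟧ L (f ∸ g) 0 (trans (cong suc (ℕₚ.+-identityʳ _)) (sym length-L)) ⟩
    ⟦ L ⟧ 0
      ≡⟨ sym (trans (cong (ℤ._* ⟦ L ⟧ 0) (reverse-lead mG)) (ℤₚ.*-identityˡ _)) ⟩
    (⟦ reverse G ⟧ ⋆ ⟦ L ⟧) 0
      ≡⟨ L-correct 0 z≤n ⟩
    ⟦ reverse F ⟧ 0
      ≡⟨ reverse-lead mF ⟩
    + 1 ∎)
    where open ≡-Reasoning

  -- The loop reproduces the f - g + 1 leading coefficients of F; below degree g the two sides may
  -- differ by the discarded remainder.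
  G⋆Q : g ≤ f → ∀ k → g ≤ k → (⟦ G ⟧ ⋆ ⟦ Q ⟧) k ≡ ⟦ F ⟧ k
  G⋆Q g≤f k g≤k with k ≤? f
  ... | yes k≤f = trans
    (sym (reverse-⋆ G Q (f ∸ k) k length-Q (trans (cong (λ z → suc (suc z)) (ℕₚ.m∸n+n≡m k≤f))
      (sym (trans (cong₂ _+_ (length≡ mG) length-Q)
        (cong suc (trans (ℕₚ.+-suc g _) (cong suc (ℕₚ.m+[n∸m]≡n g≤f)))))))))
    (trans (⋆-cong-at (f ∸ k) ≐-refl (pointwise λ n → cong (λ z → ⟦ z ⟧ n)
        (trans (cong reverse (divMonic-reverse F G)) (Listₚ.reverse-involutive L))))
    (trans (L-correct (f ∸ k) (ℕₚ.∸-monoʳ-≤ f g≤k))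
      (⟦reverse⟧ F (f ∸ k) k (trans (cong suc (ℕₚ.m∸n+n≡m k≤f)) (sym (length≡ mF))))))
  ... | no k≰f = trans
    (vanish-⋆ (suc g) (vanish mG) (subst (Vanish ⟦ Q ⟧) length-Q (⟦⟧-vanish Q)) k
      (subst (_≤ k) (cong suc (sym (ℕₚ.m+[n∸m]≡n g≤f))) (ℕₚ.≰⇒> k≰f)))
    (sym (vanish mF k (ℕₚ.≰⇒> k≰f)))

  module _ {N H} (H0 : Vanish H N) (F≐GH : ⟦ F ⟧ ≐ ⟦ G ⟧ ⋆ H) where

    g≤f : g ≤ f
    g≤f with g ≤? f
    ... | yes h = h
    ... | no h = ⊥-elim (1≢0 (trans (sym (lead≡1 mF)) (trans (coeff F≐GH f)
        (trans (⋆-cong-at f ≐-refl H≐𝟘) (trans (⋆-comm-at f ⟦ G ⟧ 𝟘) (𝟘⋆-at f ⟦ G ⟧))))))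
      where
      1≢0 : ¬ (+ 1 ≡ + 0)
      1≢0 ()
      H≐𝟘 : H ≐ 𝟘
      H≐𝟘 = monic-cancel (vanish mG) (lead≡1 mG) N H0 λ k g≤k → trans (sym (coeff F≐GH k))
        (vanish mF k (ℕₚ.≤-trans (ℕₚ.≰⇒> h) g≤k))

    -- G times the difference of quotient and H vanishes from degree g upward, so the difference is
    -- zero by `monic-cancel`.
    divMonic-exact : ⟦ divMonic F G ⟧ ≐ H
    divMonic-exact = pointwise λ n → ℤₚ.i-j≡0⇒i≡j _ _ (coeff D≐𝟘 n)
      where
      D = ⟦ Q ⟧ ⊕ ⊖ H
      G⋆D : ⟦ G ⟧ ⋆ D ≐ ⟦ G ⟧ ⋆ ⟦ Q ⟧ ⊕ ⊖ (⟦ G ⟧ ⋆ H)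
      G⋆D = solve 3 (λ a b c → a :* (b :+ :- c) := a :* b :+ :- (a :* c)) ≐-refl ⟦ G ⟧ ⟦ Q ⟧ H
      D≐𝟘 : D ≐ 𝟘
      D≐𝟘 = monic-cancel (vanish mG) (lead≡1 mG) (length Q + N)
        (λ k h → cong₂ (λ a b → a ℤ.+ ℤ.- b)
          (⟦⟧-vanish Q k (ℕₚ.≤-trans (ℕₚ.m≤m+n _ N) h)) (H0 k (ℕₚ.≤-trans (ℕₚ.m≤n+m N _) h)))
        (λ k g≤k → trans (coeff G⋆D k) (ℤₚ.i≡j⇒i-j≡0
          (trans (G⋆Q g≤f k g≤k) (coeff F≐GH k))))

open Division using (divMonic-monic; divMonic-exact)

length-+ₚ : ∀ f g → length (f +ₚ g) ≡ length f ⊔ length g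
length-+ₚ [] g = refl
length-+ₚ (a ∷ f) [] = refl
length-+ₚ (a ∷ f) (b ∷ g) = cong suc (length-+ₚ f g)

length-shift : ∀ f {n} → length f ≡ suc n → length (shift f) ≡ suc (suc n)
length-shift (a ∷ f) e = cong suc e

length-*ₚ : ∀ f g {m n} → length f ≡ suc m → length g ≡ suc n → length (f *ₚ g) ≡ suc (m + n)
length-*ₚ (a ∷ []) g refl |g| = trans (length-+ₚ (map (a ℤ.*_) g) [])
  (trans (ℕₚ.⊔-identityʳ _) (trans (Listₚ.length-map (a ℤ.*_) g) |g|))
length-*ₚ (a ∷ b ∷ f) g {n = n} refl |g| = trans (length-+ₚ (map (a ℤ.*_) g) _) (trans
  (cong₂ _⊔_ (trans (Listₚ.length-map (a ℤ.*_) g) |g|)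
    (length-shift ((b ∷ f) *ₚ g) (length-*ₚ (b ∷ f) g refl |g|)))
  (ℕₚ.m≤n⇒m⊔n≡n (s≤s (ℕₚ.m≤n⇒m≤1+n (ℕₚ.m≤n+m n (length f))))))

*ₚ-monic : ∀ {f g} → Monic f → Monic g → Monic (f *ₚ g)
*ₚ-monic {f} {g} mf@(monic {a} lf tf) mg@(monic {b} lg tg) = monic (length-*ₚ f g lf lg)
  (trans (⟦*ₚ⟧-at f g (a + b)) (trans (top-⋆ a b (vanish mf) (vanish mg)) (cong₂ ℤ._*_ tf tg)))

oneₚ-monic : Monic oneₚ
oneₚ-monic = monic refl refl

-- The binomials x^n - 1 and their quotients

module ≐-Reasoning = SetoidReasoning seriesSetoid

M : ℕ → Series
M n = X n ⊕ ⊖ 𝟙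

-- Each coefficient equals the one n + 1 degrees lower, and finally one of negative degree. N only
-- bounds the descent.
X⋆-fixed : ∀ {n D} → D ≐ X (suc n) ⋆ D → ∀ N k → k < N → D k ≡ + 0
X⋆-fixed {n} {D} e (suc N) k (s≤s k≤N) with suc n ≤? k
... | no h = trans (coeff e k) (X⋆-< (suc n) D (ℕₚ.≰⇒> h))
... | yes h = trans (coeff e k) (trans
  (trans (cong (X (suc n) ⋆ D) (sym (ℕₚ.m+[n∸m]≡n h))) (X⋆-+ (suc n) D (k ∸ suc n)))
  (X⋆-fixed e N (k ∸ suc n) (ℕₚ.<-≤-trans (ℕₚ.∸-monoʳ-< {k} {suc n} {0} (s≤s z≤n) h) k≤N)))

-- If D (x^n - 1) = 0, then D = x^n D. This lets quotients of binomials be handled through their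
-- products.
M-cancel : ∀ {n f g} → 0 < n → f ⋆ M n ≐ g ⋆ M n → f ≐ g
M-cancel {suc n} {f} {g} _ e = pointwise λ k →
  ℤₚ.i-j≡0⇒i≡j _ _ (X⋆-fixed fixed (suc k) k ℕₚ.≤-refl)
  where
  open ≐-Reasoning
  D = f ⊕ ⊖ g
  fixed : D ≐ X (suc n) ⋆ D
  fixed = begin
    D
      ≈⟨ solve 3 (λ f g x → f :+ :- g := x :* (f :+ :- g) :- (f :* (x :+ :- con (+ 1)) :- g :* (x :+ :- con (+ 1))))
           ≐-refl f g (X (suc n)) ⟩
    X (suc n) ⋆ D ⊕ ⊖ (f ⋆ M (suc n) ⊕ ⊖ (g ⋆ M (suc n)))
      ≈⟨ ⊕-cong (≐-refl {X (suc n) ⋆ D}) (pointwise λ k → cong ℤ.-_ (ℤₚ.i≡j⇒i-j≡0 (coeff e k))) ⟩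
    X (suc n) ⋆ D ⊕ 𝟘
      ≈⟨ (pointwise λ k → ℤₚ.+-identityʳ _) ⟩
    X (suc n) ⋆ D ∎

-- The quotient (x^(an) - 1) / (x^a - 1).
geo : ℕ → ℕ → Series
geo a zero = 𝟘
geo a (suc n) = geo a n ⊕ X (a * n)

X-≡ : ∀ {m n} → m ≡ n → X m ≐ X n
X-≡ refl = ≐-refl

M-≡ : ∀ {m n} → m ≡ n → M m ≐ M n
M-≡ refl = ≐-refl

geo⋆M : ∀ a n → geo a n ⋆ M a ≐ M (a * n)
geo⋆M a zero = ≐-trans (pointwise λ k → 𝟘⋆-at k (M a)) (≐-sym (≐-trans
  (⊕-cong (X-≡ (ℕₚ.*-zeroʳ a)) ≐-refl) (pointwise λ k → ℤₚ.+-inverseʳ (𝟙 k))))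
geo⋆M a (suc n) = begin
  (geo a n ⊕ X (a * n)) ⋆ M a
    ≈⟨ solve 3 (λ g x y → (g :+ x) :* (y :+ :- con (+ 1)) := g :* (y :+ :- con (+ 1)) :+ (y :* x :- x))
         ≐-refl (geo a n) (X (a * n)) (X a) ⟩
  geo a n ⋆ M a ⊕ (X a ⋆ X (a * n) ⊕ ⊖ X (a * n))
    ≈⟨ ⊕-cong (geo⋆M a n) (⊕-cong (≐-trans (X-+ a (a * n)) (X-≡ (sym (ℕₚ.*-suc a n)))) ≐-refl) ⟩
  M (a * n) ⊕ (X (a * suc n) ⊕ ⊖ X (a * n))
    ≈⟨ solve 2 (λ x y → (x :+ :- con (+ 1)) :+ (y :- x) := y :+ :- con (+ 1))
         ≐-refl (X (a * n)) (X (a * suc n)) ⟩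
  M (a * suc n) ∎
  where open ≐-Reasoning

-- Being a polynomial. It must be tracked, since `divMonic-exact` applies only to cofactors of
-- bounded degree.
Finite : Series → Set
Finite f = ∃ (Vanish f)

finite-⊕ : ∀ {f g} → Finite f → Finite g → Finite (f ⊕ g)
finite-⊕ (m , f0) (n , g0) = m + n , λ k h → cong₂ ℤ._+_
  (f0 k (ℕₚ.≤-trans (ℕₚ.m≤m+n m n) h)) (g0 k (ℕₚ.≤-trans (ℕₚ.m≤n+m n m) h))

finite-⊖ : ∀ {f} → Finite f → Finite (⊖ f)
finite-⊖ (m , f0) = m , λ k h → cong ℤ.-_ (f0 k h)

finite-⋆ : ∀ {f g} → Finite f → Finite g → Finite (f ⋆ g)
finite-⋆ (m , f0) (n , g0) = m + n , vanish-⋆ m f0 (λ k h → g0 k (ℕₚ.<⇒≤ h))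

finite-X : ∀ n → Finite (X n)
finite-X n = suc n , beyond n
  where
  beyond : ∀ n → Vanish (X n) (suc n)
  beyond zero (suc k) _ = refl
  beyond (suc n) (suc k) (s≤s h) = beyond n k h

finite-geo : ∀ a n → Finite (geo a n)
finite-geo a zero = 0 , λ _ _ → refl
finite-geo a (suc n) = finite-⊕ (finite-geo a n) (finite-X (a * n))

finite-⟦⟧ : ∀ f → Finite ⟦ f ⟧
finite-⟦⟧ f = length f , ⟦⟧-vanish f

⟦xⁿ-1⟧ : ∀ n → ⟦ xⁿ-1 n ⟧ ≐ M n
⟦xⁿ-1⟧ zero = pointwise λ k → sym (ℤₚ.+-inverseʳ (𝟙 k))
⟦xⁿ-1⟧ (suc n) = pointwise λ { zero → refl ; (suc k) → trans (top n k) (sym (ℤₚ.+-identityʳ _)) }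
  where
  top : ∀ n k → ⟦ replicate n (+ 0) ++ [ + 1 ] ⟧ k ≡ X n k
  top zero k = coeff (⟦[]⟧ (+ 1)) k
  top (suc n) zero = refl
  top (suc n) (suc k) = top n k

xⁿ-1-monic : ∀ n → Monic (xⁿ-1 (suc n))
xⁿ-1-monic n = monic (cong suc (trans (Listₚ.length-++ (replicate n (+ 0)))
    (trans (cong (_+ 1) (Listₚ.length-replicate n)) (ℕₚ.+-comm n 1))))
  (trans (coeff (⟦xⁿ-1⟧ (suc n)) (suc n)) (trans (ℤₚ.+-identityʳ _) (X-diag n)))
  where
  X-diag : ∀ n → X n n ≡ + 1
  X-diag zero = refl
  X-diag (suc n) = X-diag n

-- The table of cyclotomic polynomials

at-++ˡ : {A : Set} (d : A) → ∀ xs ys i → i < length xs → at d (xs ++ ys) i ≡ at d xs i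
at-++ˡ d (x ∷ xs) ys zero _ = refl
at-++ˡ d (x ∷ xs) ys (suc i) (s≤s h) = at-++ˡ d xs ys i h

at-∷ʳ : {A : Set} (d : A) → ∀ xs y → at d (xs ++ [ y ]) (length xs) ≡ y
at-∷ʳ d [] y = refl
at-∷ʳ d (x ∷ xs) y = at-∷ʳ d xs y

length-cycTable : ∀ n → length (cycTable n) ≡ n
length-cycTable zero = refl
length-cycTable (suc n) = trans (Listₚ.length-++ (cycTable n))
  (trans (cong (_+ 1) (length-cycTable n)) (ℕₚ.+-comm n 1))

at-cycTable : ∀ n k → k < n → at oneₚ (cycTable n) k ≡ Φ (suc k)
at-cycTable (suc n) k (s≤s k≤n) with ℕₚ.m≤n⇒m<n∨m≡n k≤n
... | inj₁ k<n = trans (at-++ˡ oneₚ (cycTable n) _ k (subst (k <_) (sym (length-cycTable n)) k<n))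
  (at-cycTable n k k<n)
... | inj₂ refl = refl

Φ-suc : ∀ n → Φ (suc n) ≡ divMonic (xⁿ-1 (suc n)) (prodDiv (suc n) n (cycTable n))
Φ-suc n = trans (cong (at oneₚ (cycTable (suc n))) (sym (length-cycTable n)))
  (at-∷ʳ oneₚ (cycTable n) _)

if-monic : ∀ (b : Bool) {f} → Monic f → Monic (if b then f else oneₚ)
if-monic true m = m
if-monic false m = oneₚ-monic

divisorFactor : ℕ → List Poly → ℕ → Poly
divisorFactor m T k = if ⌊ suc k ∣? m ⌋ then at oneₚ T k else oneₚ

prodDiv-monic : ∀ m n T → (∀ k → Monic (at oneₚ T k)) → Monic (prodDiv m n T)
prodDiv-monic m n T mT = go (upTo n)
  where
  go : ∀ ks → Monic (foldr (λ k acc → divisorFactor m T k *ₚ acc) oneₚ ks)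
  go [] = oneₚ-monic
  go (k ∷ ks) = *ₚ-monic (if-monic ⌊ suc k ∣? m ⌋ (mT k)) (go ks)

at-monic : ∀ T f → (∀ k → Monic (at oneₚ T k)) → Monic f → ∀ k → Monic (at oneₚ (T ++ [ f ]) k)
at-monic [] f mT mf zero = mf
at-monic [] f mT mf (suc k) = oneₚ-monic
at-monic (_ ∷ T) f mT mf zero = mT 0
at-monic (_ ∷ T) f mT mf (suc k) = at-monic T f (λ i → mT (suc i)) mf k

-- True for every position, as the default entry `oneₚ` is itself monic.
cycTable-monic : ∀ n k → Monic (at oneₚ (cycTable n) k)
cycTable-monic zero k = oneₚ-monic
cycTable-monic (suc n) = at-monic (cycTable n) _ (cycTable-monic n)
  (divMonic-monic (xⁿ-1-monic n) (prodDiv-monic (suc n) n (cycTable n) (cycTable-monic n)))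

Φ-monic : ∀ n → Monic (Φ n)
Φ-monic n = cycTable-monic n (n ∸ 1)

-- Products over the proper divisors

∏ : ℕ → (ℕ → Series) → Series
∏ zero c = 𝟙
∏ (suc n) c = c 0 ⋆ ∏ n (λ k → c (suc k))

∏-cong : ∀ n {c d : ℕ → Series} → (∀ k → k < n → c k ≐ d k) → ∏ n c ≐ ∏ n d
∏-cong zero e = ≐-refl
∏-cong (suc n) e = ⋆-cong (e 0 (s≤s z≤n)) (∏-cong n λ k k<n → e (suc k) (s≤s k<n))

∏-⋆ : ∀ n c d → ∏ n (λ k → c k ⋆ d k) ≐ ∏ n c ⋆ ∏ n d
∏-⋆ zero c d = ≐-sym (⋆-identityˡ 𝟙)
∏-⋆ (suc n) c d = ≐-trans (⋆-cong ≐-refl (∏-⋆ n (λ k → c (suc k)) (λ k → d (suc k))))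
  (solve 4 (λ a b x y → (a :* b) :* (x :* y) := (a :* x) :* (b :* y)) ≐-refl _ _ _ _)

∏-𝟙 : ∀ n → ∏ n (λ _ → 𝟙) ≐ 𝟙
∏-𝟙 zero = ≐-refl
∏-𝟙 (suc n) = ≐-trans (⋆-identityˡ _) (∏-𝟙 n)

single : ℕ → Series → ℕ → Series
single i f k = if k ≡ᵇ i then f else 𝟙

∏-single : ∀ n i f → i < n → ∏ n (single i f) ≐ f
∏-single (suc n) zero f _ = ≐-trans (⋆-cong ≐-refl (∏-𝟙 n))
  (≐-trans (⋆-comm f 𝟙) (⋆-identityˡ f))
∏-single (suc n) (suc i) f (s≤s h) = ≐-trans (⋆-identityˡ _) (∏-single n i f h)

single-≡ : ∀ i f → single i f i ≡ f
single-≡ zero f = refl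
single-≡ (suc i) f = single-≡ i f

single-≢ : ∀ i f k → ¬ (k ≡ i) → single i f k ≡ 𝟙
single-≢ zero f zero k≢i = ⊥-elim (k≢i refl)
single-≢ zero f (suc k) k≢i = refl
single-≢ (suc i) f zero k≢i = refl
single-≢ (suc i) f (suc k) k≢i = single-≢ i f k λ e → k≢i (cong suc e)

∏ᴸ : (ℕ → Series) → List ℕ → Series
∏ᴸ w = foldr (λ d acc → w d ⋆ acc) 𝟙

-- Reduces the product over all of 1, ..., n, with entries 1 at non-divisors, to a product over a
-- list of divisors: c is written as a pointwise product of functions `single`, one for each member
-- of ds, and the two products are interchanged.
∏-support : ∀ n {c w : ℕ → Series} ds → Unique ds → All (λ d → 0 < d × d ≤ n) ds →
  (∀ d → d ∈ ds → c d ≐ w d) → (∀ d → 0 < d → d ≤ n → d ∉ ds → c d ≐ 𝟙) →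
  ∏ n (λ k → c (suc k)) ≐ ∏ᴸ w ds
∏-support n {c} {w} ds u b inside outside = ≐-trans (∏-cong n split) (∏-factors ds b)
  where
  factors : List ℕ → ℕ → Series
  factors ds d = ∏ᴸ (λ e → single e (w e) d) ds

  factors-∉ : ∀ ds d → d ∉ ds → factors ds d ≐ 𝟙
  factors-∉ [] d _ = ≐-refl
  factors-∉ (e ∷ ds) d d∉ rewrite single-≢ e (w e) d (λ p → d∉ (here p)) =
    ≐-trans (⋆-identityˡ _) (factors-∉ ds d λ p → d∉ (there p))

  factors-∈ : ∀ ds → Unique ds → ∀ d → d ∈ ds → factors ds d ≐ w d
  factors-∈ (e ∷ ds) (e∉ ∷ _) d (here refl) rewrite single-≡ d (w d) =
    ≐-trans (⋆-cong ≐-refl (factors-∉ ds d λ p → All.lookup e∉ p refl))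
      (≐-trans (⋆-comm (w d) 𝟙) (⋆-identityˡ _))
  factors-∈ (e ∷ ds) (e∉ ∷ u) d (there p)
    rewrite single-≢ e (w e) d (λ q → All.lookup e∉ p (sym q)) =
    ≐-trans (⋆-identityˡ _) (factors-∈ ds u d p)

  split : ∀ k → k < n → c (suc k) ≐ factors ds (suc k)
  split k k<n with suc k ∈? ds
  ... | yes p = ≐-trans (inside _ p) (≐-sym (factors-∈ ds u _ p))
  ... | no p = ≐-trans (outside _ (s≤s z≤n) k<n p) (≐-sym (factors-∉ ds _ p))

  ∏-factors : ∀ ds → All (λ d → 0 < d × d ≤ n) ds → ∏ n (λ k → factors ds (suc k)) ≐ ∏ᴸ w ds
  ∏-factors [] [] = ∏-𝟙 n
  ∏-factors (suc i ∷ ds) ((_ , i<n) ∷ b) = ≐-trans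
    (∏-⋆ n (single i (w (suc i))) (λ k → factors ds (suc k)))
    (⋆-cong (∏-single n i (w (suc i)) i<n) (∏-factors ds b))

⟦prodDiv⟧ : ∀ m n T → ⟦ prodDiv m n T ⟧ ≐ ∏ n (λ k → ⟦ divisorFactor m T k ⟧)
⟦prodDiv⟧ m n T = go n (λ k → k)
  where
  go : ∀ n (f : ℕ → ℕ) → ⟦ foldr (λ k acc → divisorFactor m T k *ₚ acc) oneₚ (applyUpTo f n) ⟧ ≐
    ∏ n (λ k → ⟦ divisorFactor m T (f k) ⟧)
  go zero f = ⟦[]⟧ (+ 1)
  go (suc n) f = ≐-trans (⟦*ₚ⟧ (divisorFactor m T (f 0)) _) (⋆-cong ≐-refl (go n (λ k → f (suc k))))

-- The criterion that identifies each cyclotomic polynomial below: ds lists the proper divisors, and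
-- a polynomial cofactor H is exhibited.
Φ-exact : ∀ n ds → 0 < n → Unique ds → All (λ d → d ∣ n × ¬ (d ≡ n)) ds →
  (∀ d → d ∣ n → ¬ (d ≡ n) → d ∈ ds) →
  ∀ {H} → Finite H → ∏ᴸ (λ d → ⟦ Φ d ⟧) ds ⋆ H ≐ M n → ⟦ Φ n ⟧ ≐ H
Φ-exact (suc n) ds _ u proper complete {H} (N , H0) e = ≐-trans
  (pointwise λ k → cong (λ z → ⟦ z ⟧ k) (Φ-suc n))
  (divMonic-exact (xⁿ-1-monic n) (prodDiv-monic (suc n) n (cycTable n) (cycTable-monic n)) H0
    (≐-trans (⟦xⁿ-1⟧ (suc n)) (≐-trans (≐-sym e) (⋆-cong (≐-sym prod) ≐-refl))))
  where
  factor : ℕ → Series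
  factor zero = 𝟙
  factor (suc k) = ⟦ divisorFactor (suc n) (cycTable n) k ⟧
  bound : ∀ {d} → d ∣ suc n × ¬ (d ≡ suc n) → 0 < d × d ≤ n
  bound {zero} (divides q eq , _) with trans eq (ℕₚ.*-zeroʳ q)
  ... | ()
  bound {suc d} (d∣ , d≢) = s≤s z≤n , ℕₚ.≤-pred (ℕₚ.≤∧≢⇒< (∣⇒≤ d∣) d≢)
  inside : ∀ d → d ∈ ds → factor d ≐ ⟦ Φ d ⟧
  inside zero d∈ with bound (All.lookup proper d∈)
  ... | () , _
  inside (suc k) d∈ with suc k ∣? suc n
  ... | yes _ = pointwise λ i → cong (λ z → ⟦ z ⟧ i)
    (at-cycTable n k (proj₂ (bound (All.lookup proper d∈))))
  ... | no ¬d = ⊥-elim (¬d (proj₁ (All.lookup proper d∈)))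
  outside : ∀ d → 0 < d → d ≤ n → d ∉ ds → factor d ≐ 𝟙
  outside (suc k) _ k<n d∉ with suc k ∣? suc n
  ... | no _ = ⟦[]⟧ (+ 1)
  ... | yes d∣ = ⊥-elim (d∉ (complete (suc k) d∣ λ e → ℕₚ.<⇒≢ (s≤s k<n) e))
  prod : ⟦ prodDiv (suc n) n (cycTable n) ⟧ ≐ ∏ᴸ (λ d → ⟦ Φ d ⟧) ds
  prod = ≐-trans (⟦prodDiv⟧ (suc n) n (cycTable n))
    (∏-support n {factor} {λ d → ⟦ Φ d ⟧} ds u (All.map bound proper) inside outside)

-- Inverses modulo coprime numbers and the polynomials built from them

record Split (a b : ℕ) : Set where
  field
    -- α inverts a modulo b and γ inverts b modulo a, with a α + b γ = a b + 1; α′ = b - α and γ′ =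
    -- a - γ are kept as fields to avoid subtraction.
    {α α′ γ γ′} : ℕ
    b≡ : b ≡ α + α′
    a≡ : a ≡ γ + γ′
    a*α≡ : a * α ≡ suc (b * γ′)
    b*γ≡ : b * γ ≡ suc (a * α′)

  a*b≡ : a * b ≡ suc (b * γ′ + a * α′)
  a*b≡ = trans (cong (a *_) b≡) (trans (ℕₚ.*-distribˡ-+ a α α′) (cong (_+ a * α′) a*α≡))

split-swap : ∀ {a b} → Split a b → Split b a
split-swap s = record { b≡ = a≡ ; a≡ = b≡ ; a*α≡ = b*γ≡ ; b*γ≡ = a*α≡ }
  where open Split s

inverse⇒split : ∀ {a b} α γ′ → α < b → a * α ≡ suc (b * γ′) → Split a b
inverse⇒split {a} {b} α γ′ α<b e = record
  { b≡ = b≡ ; a≡ = trans a≡ (ℕₚ.+-comm γ′ (a ∸ γ′)) ; a*α≡ = e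
  ; b*γ≡ = ℕₚ.+-cancelʳ-≡ (b * γ′) _ _ (begin
      b * (a ∸ γ′) + b * γ′     ≡⟨ sym (ℕₚ.*-distribˡ-+ b (a ∸ γ′) γ′) ⟩
      b * (a ∸ γ′ + γ′)           ≡⟨ cong (b *_) (ℕₚ.m∸n+n≡m γ′≤a) ⟩
      b * a                         ≡⟨ ℕₚ.*-comm b a ⟩
      a * b                         ≡⟨ cong (a *_) b≡ ⟩
      a * (α + (b ∸ α))           ≡⟨ ℕₚ.*-distribˡ-+ a α (b ∸ α) ⟩
      a * α + a * (b ∸ α)       ≡⟨ cong (_+ a * (b ∸ α)) e ⟩
      suc (b * γ′ + a * (b ∸ α)) ≡⟨ cong suc (ℕₚ.+-comm (b * γ′) _) ⟩
      suc (a * (b ∸ α) + b * γ′) ∎) }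
  where
  open ≡-Reasoning
  b≡ : b ≡ α + (b ∸ α)
  b≡ = sym (ℕₚ.m+[n∸m]≡n (ℕₚ.<⇒≤ α<b))
  γ′≤a : γ′ ≤ a
  γ′≤a = ℕₚ.<⇒≤ (ℕₚ.*-cancelˡ-< b γ′ a (ℕₚ.<-≤-trans (ℕₚ.≤-reflexive (sym e))
    (ℕₚ.≤-trans (ℕₚ.*-monoʳ-≤ a (ℕₚ.<⇒≤ α<b)) (ℕₚ.≤-reflexive (ℕₚ.*-comm a b)))))
  a≡ : a ≡ γ′ + (a ∸ γ′)
  a≡ = sym (ℕₚ.m+[n∸m]≡n γ′≤a)

Bézout⇒split : ∀ {a b} → 1 < b → ∀ x y → 1 + y * b ≡ x * a → Split a b
Bézout⇒split {a} {b@(suc (suc _))} (s≤s (s≤s _)) x y e =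
  -- The Bézout coefficient x may exceed b; its residue is still an inverse of a modulo b.
  inverse⇒split (x % b) (a * (x % b) / b) (m%n<n x b) (begin
    a * (x % b)
      ≡⟨ m≡m%n+[m/n]*n (a * (x % b)) b ⟩
    a * (x % b) % b + (a * (x % b) / b) * b
      ≡⟨ cong₂ _+_ residue (ℕₚ.*-comm (a * (x % b) / b) b) ⟩
    suc (b * (a * (x % b) / b)) ∎)
  where
  open ≡-Reasoning
  residue : a * (x % b) % b ≡ 1
  residue = begin
    a * (x % b) % b             ≡⟨ %-distribˡ-* a (x % b) b ⟩
    (a % b) * (x % b % b) % b   ≡⟨ cong (λ z → (a % b) * z % b) (m<n⇒m%n≡m (m%n<n x b)) ⟩
    (a % b) * (x % b) % b       ≡⟨ sym (%-distribˡ-* a x b) ⟩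
    a * x % b                   ≡⟨ cong (_% b) (trans (ℕₚ.*-comm a x) (sym e)) ⟩
    (1 + y * b) % b           ≡⟨ [m+kn]%n≡m%n 1 y b ⟩
    1 % b                         ≡⟨ refl ⟩
    1 ∎

coprime⇒split : ∀ {a b} → 1 < a → 1 < b → Coprime a b → Split a b
coprime⇒split 1<a 1<b c with coprime-Bézout c
... | Bézout.+- x y e = Bézout⇒split 1<b x y e
... | Bézout.-+ x y e = split-swap (Bézout⇒split 1<a y x e)

-- Used with z = x^d, u = x^(daα′), v = x^(dbγ′): the two grids of `binary` brought over the common
-- denominator (x^(da) - 1)(x^(db) - 1).
binary-numerator : ∀ z u v → (z ⋆ v ⊕ ⊖ 𝟙) ⋆ (z ⋆ u ⊕ ⊖ 𝟙) ⊕ ⊖ (z ⋆ ((u ⊕ ⊖ 𝟙) ⋆ (v ⊕ ⊖ 𝟙))) ≐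
  (z ⋆ (v ⋆ u) ⊕ ⊖ 𝟙) ⋆ (z ⊕ ⊖ 𝟙)
binary-numerator = solve 3 (λ z u v →
  (z :* v :+ :- con (+ 1)) :* (z :* u :+ :- con (+ 1)) :+
    :- (z :* ((u :+ :- con (+ 1)) :* (v :+ :- con (+ 1)))) :=
  (z :* (v :* u) :+ :- con (+ 1)) :* (z :+ :- con (+ 1))) ≐-refl

module _ {a b} (s : Split a b) where
  open Split s

  -- The polynomial (x^(dab) - 1)(x^d - 1) / ((x^(da) - 1)(x^(db) - 1)).
  binary : ℕ → Series
  binary d = geo (d * a) α ⋆ geo (d * b) γ ⊕ ⊖ (X d ⋆ (geo (d * a) α′ ⋆ geo (d * b) γ′))

  finite-binary : ∀ d → Finite (binary d)
  finite-binary d = finite-⊕ (finite-⋆ (finite-geo _ α) (finite-geo _ γ))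
    (finite-⊖ (finite-⋆ (finite-X d) (finite-⋆ (finite-geo _ α′) (finite-geo _ γ′))))

  binary⋆M⋆M : ∀ d → binary d ⋆ (M (d * a) ⋆ M (d * b)) ≐ M (d * (a * b)) ⋆ M d
  binary⋆M⋆M d = begin
    binary d ⋆ (M da ⋆ M db)
      ≈⟨ solve 7 (λ g₁ g₂ g₃ g₄ z m n → (g₁ :* g₂ :+ :- (z :* (g₃ :* g₄))) :* (m :* n) :=
           (g₁ :* m) :* (g₂ :* n) :+ :- (z :* ((g₃ :* m) :* (g₄ :* n))))
           ≐-refl (geo da α) (geo db γ) (geo da α′) (geo db γ′) (X d) (M da) (M db) ⟩
    (geo da α ⋆ M da) ⋆ (geo db γ ⋆ M db) ⊕ ⊖ (X d ⋆ ((geo da α′ ⋆ M da) ⋆ (geo db γ′ ⋆ M db)))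
      ≈⟨ ⊕-cong (⋆-cong (≐-trans (geo⋆M da α) (M-+ da≡)) (≐-trans (geo⋆M db γ) (M-+ db≡)))
           (pointwise λ k → cong ℤ.-_ (coeff (⋆-cong (≐-refl {X d}) (⋆-cong (geo⋆M da α′) (geo⋆M db γ′))) k)) ⟩
    (X d ⋆ v ⊕ ⊖ 𝟙) ⋆ (X d ⋆ u ⊕ ⊖ 𝟙) ⊕ ⊖ (X d ⋆ ((u ⊕ ⊖ 𝟙) ⋆ (v ⊕ ⊖ 𝟙)))
      ≈⟨ binary-numerator (X d) u v ⟩
    (X d ⋆ (v ⋆ u) ⊕ ⊖ 𝟙) ⋆ M d
      ≈⟨ ⋆-cong (⊕-cong (≐-trans (⋆-cong ≐-refl (X-+ (db * γ′) (da * α′)))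
           (≐-trans (X-+ d _) (X-≡ (sym dab≡)))) ≐-refl) ≐-refl ⟩
    M (d * (a * b)) ⋆ M d ∎
    where
    open ≐-Reasoning
    da = d * a
    db = d * b
    u = X (da * α′)
    v = X (db * γ′)
    M-+ : ∀ {n k} → n ≡ d + k → M n ≐ X d ⋆ X k ⊕ ⊖ 𝟙
    M-+ refl = ⊕-cong (≐-sym (X-+ d _)) ≐-refl
    distrib : ∀ {m} n k → m ≡ suc (n * k) → d * m ≡ d + d * n * k
    distrib n k refl = trans (ℕₚ.*-suc d (n * k)) (cong (d ℕ.+_) (sym (ℕₚ.*-assoc d n k)))
    da≡ : da * α ≡ d + db * γ′
    da≡ = trans (ℕₚ.*-assoc d a α) (distrib b γ′ a*α≡)
    db≡ : db * γ ≡ d + da * α′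
    db≡ = trans (ℕₚ.*-assoc d b γ) (distrib a α′ b*γ≡)
    dab≡ : d * (a * b) ≡ d + (db * γ′ + da * α′)
    dab≡ = trans (cong (d *_) a*b≡) (expand d a b γ′ α′)
      where
      expand : ∀ d a b c e → d * suc (b * c + a * e) ≡ d + (d * b * c + d * a * e)
      expand = ℕ-solve-∀

  -- Cofactors expressing x^d - 1 through x^(da) - 1 and x^(db) - 1. From d a α = d + d b γ′ follows
  -- (x^(daα) - 1) - x^d (x^(dbγ′) - 1) = x^d - 1.
  bézoutˡ bézoutʳ : ℕ → Series
  bézoutˡ d = geo (d * a) α
  bézoutʳ d = ⊖ (X d ⋆ geo (d * b) γ′)

  finite-bézoutˡ : ∀ d → Finite (bézoutˡ d)
  finite-bézoutˡ d = finite-geo (d * a) α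

  finite-bézoutʳ : ∀ d → Finite (bézoutʳ d)
  finite-bézoutʳ d = finite-⊖ (finite-⋆ (finite-X d) (finite-geo (d * b) γ′))

  bézout-M : ∀ d → bézoutˡ d ⋆ M (d * a) ⊕ bézoutʳ d ⋆ M (d * b) ≐ M d
  bézout-M d = begin
    bézoutˡ d ⋆ M da ⊕ bézoutʳ d ⋆ M db
      ≈⟨ solve 5 (λ g h z m n → g :* m :+ (:- (z :* h)) :* n := g :* m :+ :- (z :* (h :* n)))
           ≐-refl (geo da α) (geo db γ′) (X d) (M da) (M db) ⟩
    geo da α ⋆ M da ⊕ ⊖ (X d ⋆ (geo db γ′ ⋆ M db))
      ≈⟨ ⊕-cong (≐-trans (geo⋆M da α) (⊕-cong (≐-trans (X-≡ da≡) (≐-sym (X-+ d (db * γ′)))) ≐-refl))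
           (pointwise λ k → cong ℤ.-_ (coeff (⋆-cong (≐-refl {X d}) (geo⋆M db γ′)) k)) ⟩
    (X d ⋆ X (db * γ′) ⊕ ⊖ 𝟙) ⊕ ⊖ (X d ⋆ (X (db * γ′) ⊕ ⊖ 𝟙))
      ≈⟨ solve 2 (λ z v → (z :* v :+ :- con (+ 1)) :+ :- (z :* (v :+ :- con (+ 1))) := z :+ :- con (+ 1))
           ≐-refl (X d) (X (db * γ′)) ⟩
    M d ∎
    where
    open ≐-Reasoning
    da = d * a
    db = d * b
    da≡ : da * α ≡ d + db * γ′
    da≡ = trans (ℕₚ.*-assoc d a α) (trans (cong (d *_) a*α≡)
      (trans (ℕₚ.*-suc d (b * γ′)) (cong (d ℕ.+_) (sym (ℕₚ.*-assoc d b γ′)))))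

-- Cyclotomic polynomials of products of at most three primes

prime>1 : ∀ {p} → Prime p → 1 < p
prime>1 {p} pp = ℕ.nonTrivial⇒n>1 p ⦃ prime⇒nonTrivial pp ⦄

prime>0 : ∀ {p} → Prime p → 0 < p
prime>0 pp = ℕₚ.<⇒≤ (prime>1 pp)

primes-coprime : ∀ {p q} → Prime p → Prime q → ¬ (p ≡ q) → Coprime p q
primes-coprime pp pq p≢q (d∣p , d∣q) with prime⇒irreducible pp d∣p | prime⇒irreducible pq d∣q
... | inj₁ d≡1 | _ = d≡1
... | inj₂ _ | inj₁ d≡1 = d≡1
... | inj₂ d≡p | inj₂ d≡q = ⊥-elim (p≢q (trans (sym d≡p) d≡q))

∣prime* : ∀ {p n d} → Prime p → d ∣ p * n → d ∣ n ⊎ ∃ λ e → d ≡ p * e × e ∣ n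
∣prime* {p} {n} {d} pp d∣ with p ∣? d
... | yes (divides e d≡) = inj₂ (e , trans d≡ (ℕₚ.*-comm e p) ,
  *-cancelˡ-∣ p ⦃ prime⇒nonZero pp ⦄ (subst (_∣ p * n) (trans d≡ (ℕₚ.*-comm e p)) d∣))
... | no p∤d = inj₁ (coprime-divisor coprime d∣)
  where
  coprime : Coprime d p
  coprime (k∣d , k∣p) with prime⇒irreducible pp k∣p
  ... | inj₁ k≡1 = k≡1
  ... | inj₂ refl = ⊥-elim (p∤d k∣d)

P : ℕ → Series
P n = ⟦ Φ n ⟧

finite-P : ∀ n → Finite (P n)
finite-P n = finite-⟦⟧ (Φ n)

P-1 : P 1 ≐ M 1
P-1 = Φ-exact 1 [] (s≤s z≤n) [] [] (λ d d∣1 d≢1 → ⊥-elim (d≢1 (∣1⇒≡1 d∣1)))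
  (finite-⊕ (finite-X 1) (finite-⊖ (1 , λ { (suc k) _ → refl }))) (⋆-identityˡ (M 1))

P-prime : ∀ {p} → Prime p → P 1 ⋆ P p ≐ M p
P-prime {p} pp = ≐-trans (⋆-cong P-1 P-p) geo-p
  where
  geo-p : M 1 ⋆ geo 1 p ≐ M p
  geo-p = ≐-trans (⋆-comm (M 1) (geo 1 p)) (≐-trans (geo⋆M 1 p) (M-≡ (ℕₚ.*-identityˡ p)))
  complete : ∀ d → d ∣ p → ¬ (d ≡ p) → d ∈ 1 ∷ []
  complete d d∣p d≢p with prime⇒irreducible pp d∣p
  ... | inj₁ d≡1 = here d≡1
  ... | inj₂ d≡p = ⊥-elim (d≢p d≡p)
  P-p : P p ≐ geo 1 p
  P-p = Φ-exact p (1 ∷ []) (prime>0 pp) ([] ∷ []) ((1∣ p , ℕₚ.<⇒≢ (prime>1 pp)) ∷ []) complete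
    (finite-geo 1 p)
    (≐-trans (⋆-cong (≐-trans (⋆-comm (P 1) 𝟙) (≐-trans (⋆-identityˡ (P 1)) P-1)) ≐-refl) geo-p)

m<m*n : ∀ {m n} → 0 < m → 1 < n → m < m * n
m<m*n {m} {n} 0<m 1<n = ℕₚ.m<m*n m n ⦃ ℕ.>-nonZero 0<m ⦄ 1<n

m<n*m : ∀ {m n} → 0 < m → 1 < n → m < n * m
m<n*m {m} {n} 0<m 1<n = subst (m <_) (ℕₚ.*-comm m n) (m<m*n 0<m 1<n)

module _ {p q} (pp : Prime p) (pq : Prime q) (p≢q : ¬ (p ≡ q)) (s : Split p q) where

  private
    0<pq : 0 < p * q
    0<pq = ℕₚ.<-trans (prime>0 pp) (m<m*n (prime>0 pp) (prime>1 pq))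

    complete : ∀ d → d ∣ p * q → ¬ (d ≡ p * q) → d ∈ 1 ∷ p ∷ q ∷ []
    complete d d∣ d≢ with ∣prime* pp d∣
    ... | inj₁ d∣q with prime⇒irreducible pq d∣q
    ...   | inj₁ d≡1 = here d≡1
    ...   | inj₂ d≡q = there (there (here d≡q))
    complete d d∣ d≢ | inj₂ (e , d≡pe , e∣q) with prime⇒irreducible pq e∣q
    ...   | inj₁ refl = there (here (trans d≡pe (ℕₚ.*-identityʳ p)))
    ...   | inj₂ refl = ⊥-elim (d≢ d≡pe)

    product : ∏ᴸ P (1 ∷ p ∷ q ∷ []) ⋆ binary s 1 ≐ M (p * q)
    -- The additional factor x - 1 = Φ₁ lets the product regroup as (Φ₁ Φ_p)(Φ₁ Φ_q), the
    -- denominator of `binary s 1`.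
    product = M-cancel (s≤s z≤n) (begin
      ∏ᴸ P (1 ∷ p ∷ q ∷ []) ⋆ binary s 1 ⋆ M 1
        ≈⟨ ⋆-cong ≐-refl (≐-sym P-1) ⟩
      ∏ᴸ P (1 ∷ p ∷ q ∷ []) ⋆ binary s 1 ⋆ P 1
        ≈⟨ solve 4 (λ a b c h → (a :* (b :* (c :* con (+ 1)))) :* h :* a := h :* ((a :* b) :* (a :* c)))
             ≐-refl (P 1) (P p) (P q) (binary s 1) ⟩
      binary s 1 ⋆ ((P 1 ⋆ P p) ⋆ (P 1 ⋆ P q))
        ≈⟨ ⋆-cong ≐-refl (⋆-cong (≐-trans (P-prime pp) (M-≡ (sym (ℕₚ.*-identityˡ p))))
             (≐-trans (P-prime pq) (M-≡ (sym (ℕₚ.*-identityˡ q))))) ⟩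
      binary s 1 ⋆ (M (1 * p) ⋆ M (1 * q))
        ≈⟨ binary⋆M⋆M s 1 ⟩
      M (1 * (p * q)) ⋆ M 1
        ≈⟨ ⋆-cong (M-≡ (ℕₚ.*-identityˡ (p * q))) ≐-refl ⟩
      M (p * q) ⋆ M 1 ∎)
      where open ≐-Reasoning

  P-pq≐binary : P (p * q) ≐ binary s 1
  P-pq≐binary = Φ-exact (p * q) (1 ∷ p ∷ q ∷ []) 0<pq
    ((ℕₚ.<⇒≢ (prime>1 pp) ∷ ℕₚ.<⇒≢ (prime>1 pq) ∷ []) ∷ (p≢q ∷ []) ∷ [] ∷ [])
    ((1∣ _ , ℕₚ.<⇒≢ (ℕₚ.<-trans (prime>1 pp) (m<m*n (prime>0 pp) (prime>1 pq))))
      ∷ (m∣m*n q , ℕₚ.<⇒≢ (m<m*n (prime>0 pp) (prime>1 pq)))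
      ∷ (n∣m*n p , ℕₚ.<⇒≢ (m<n*m (prime>0 pq) (prime>1 pp))) ∷ [])
    complete (finite-binary s 1) product

  P-pq : P 1 ⋆ (P p ⋆ (P q ⋆ P (p * q))) ≐ M (p * q)
  P-pq = ≐-trans
    (solve 4 (λ a b c h → a :* (b :* (c :* h)) := (a :* (b :* (c :* con (+ 1)))) :* h)
      ≐-refl (P 1) (P p) (P q) (P (p * q)))
    (≐-trans (⋆-cong ≐-refl P-pq≐binary) product)

module ThreePrimes {p q r} (pp : Prime p) (pq : Prime q) (pr : Prime r)
                   (p<q : p < q) (q<r : q < r) where

  private
    n : ℕ
    n = p * q * r

    p<r = ℕₚ.<-trans p<q q<r
    p≢q = ℕₚ.<⇒≢ p<q
    q≢r = ℕₚ.<⇒≢ q<r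
    p≢r = ℕₚ.<⇒≢ p<r
    1<p = prime>1 pp
    1<q = prime>1 pq
    1<r = prime>1 pr
    0<p = prime>0 pp
    0<q = prime>0 pq
    0<r = prime>0 pr
    spq = coprime⇒split 1<p 1<q (primes-coprime pp pq p≢q)
    spr = coprime⇒split 1<p 1<r (primes-coprime pp pr p≢r)
    sqr = coprime⇒split 1<q 1<r (primes-coprime pq pr q≢r)

    ds : List ℕ
    ds = 1 ∷ p ∷ q ∷ r ∷ p * q ∷ p * r ∷ q * r ∷ []

    p<pq = m<m*n 0<p 1<q
    q<pq = m<n*m 0<q 1<p
    r<pr = m<n*m 0<r 1<p
    pq<pr : p * q < p * r
    pq<pr = ℕₚ.*-monoʳ-< p ⦃ ℕ.>-nonZero 0<p ⦄ q<r
    pr<qr : p * r < q * r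
    pr<qr = ℕₚ.*-monoˡ-< r ⦃ ℕ.>-nonZero 0<r ⦄ p<q
    pq<qr = ℕₚ.<-trans pq<pr pr<qr
    qr<n : q * r < n
    qr<n = ℕₚ.*-monoˡ-< r ⦃ ℕ.>-nonZero 0<r ⦄ q<pq
    r≢pq : ¬ (r ≡ p * q)
    r≢pq refl with prime⇒irreducible pr (m∣m*n q)
    ... | inj₁ p≡1 = ℕₚ.<⇒≢ 1<p (sym p≡1)
    ... | inj₂ p≡r = p≢r p≡r

    infixr 5 _<<_
    _<<_ : ∀ {a b c : ℕ} → a < b → b < c → a < c
    _<<_ = ℕₚ.<-trans

    unique : Unique ds
    unique =
      (≢ 1<p ∷ ≢ 1<q ∷ ≢ 1<r ∷ ≢ (1<p << p<pq) ∷ ≢ (1<r << r<pr) ∷ ≢ (1<r << r<pr << pr<qr) ∷ []) ∷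
      (p≢q ∷ p≢r ∷ ≢ p<pq ∷ ≢ (p<r << r<pr) ∷ ≢ (p<r << r<pr << pr<qr) ∷ []) ∷
      (q≢r ∷ ≢ q<pq ∷ ≢ (q<r << r<pr) ∷ ≢ (q<r << r<pr << pr<qr) ∷ []) ∷
      (r≢pq ∷ ≢ r<pr ∷ ≢ (r<pr << pr<qr) ∷ []) ∷
      (≢ pq<pr ∷ ≢ pq<qr ∷ []) ∷ (≢ pr<qr ∷ []) ∷ [] ∷ []
      where
      ≢ : ∀ {a b : ℕ} → a < b → ¬ (a ≡ b)
      ≢ = ℕₚ.<⇒≢

    n≡p*[q*r] : n ≡ p * (q * r)
    n≡p*[q*r] = ℕₚ.*-assoc p q r
    n≡q*[p*r] : n ≡ q * (p * r)
    n≡q*[p*r] = trans (cong (_* r) (ℕₚ.*-comm p q)) (ℕₚ.*-assoc q p r)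
    n≡r*[p*q] : n ≡ r * (p * q)
    n≡r*[p*q] = ℕₚ.*-comm (p * q) r

    proper : All (λ d → d ∣ n × ¬ (d ≡ n)) ds
    proper =
      (1∣ n , ≢ (1<r << r<pr << pr<qr << qr<n)) ∷
      (subst (p ∣_) (sym n≡p*[q*r]) (m∣m*n (q * r)) , ≢ (p<r << r<pr << pr<qr << qr<n)) ∷
      (subst (q ∣_) (sym n≡q*[p*r]) (m∣m*n (p * r)) , ≢ (q<r << r<pr << pr<qr << qr<n)) ∷
      (n∣m*n (p * q) , ≢ (r<pr << pr<qr << qr<n)) ∷
      (m∣m*n r , ≢ (pq<qr << qr<n)) ∷
      (subst (p * r ∣_) (sym n≡q*[p*r]) (n∣m*n q) , ≢ (pr<qr << qr<n)) ∷
      (subst (q * r ∣_) (sym n≡p*[q*r]) (n∣m*n p) , ≢ qr<n) ∷ []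
      where
      ≢ : ∀ {a b : ℕ} → a < b → ¬ (a ≡ b)
      ≢ = ℕₚ.<⇒≢

    divisors-qr : ∀ d → d ∣ q * r → d ≡ 1 ⊎ d ≡ r ⊎ d ≡ q ⊎ d ≡ q * r
    divisors-qr d d∣ with ∣prime* pq d∣
    ... | inj₁ d∣r with prime⇒irreducible pr d∣r
    ...   | inj₁ d≡1 = inj₁ d≡1
    ...   | inj₂ d≡r = inj₂ (inj₁ d≡r)
    divisors-qr d d∣ | inj₂ (e , d≡qe , e∣r) with prime⇒irreducible pr e∣r
    ...   | inj₁ refl = inj₂ (inj₂ (inj₁ (trans d≡qe (ℕₚ.*-identityʳ q))))
    ...   | inj₂ refl = inj₂ (inj₂ (inj₂ d≡qe))

    complete : ∀ d → d ∣ n → ¬ (d ≡ n) → d ∈ ds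
    complete d d∣n d≢n with ∣prime* pp (subst (d ∣_) n≡p*[q*r] d∣n)
    ... | inj₁ d∣qr with divisors-qr d d∣qr
    ...   | inj₁ d≡1 = here d≡1
    ...   | inj₂ (inj₁ d≡r) = there (there (there (here d≡r)))
    ...   | inj₂ (inj₂ (inj₁ d≡q)) = there (there (here d≡q))
    ...   | inj₂ (inj₂ (inj₂ d≡qr)) = there (there (there (there (there (there (here d≡qr))))))
    complete d d∣n d≢n | inj₂ (e , d≡pe , e∣qr) with divisors-qr e e∣qr
    ...   | inj₁ refl = there (here (trans d≡pe (ℕₚ.*-identityʳ p)))
    ...   | inj₂ (inj₁ refl) = there (there (there (there (there (here d≡pe)))))
    ...   | inj₂ (inj₂ (inj₁ refl)) = there (there (there (there (here d≡pe))))
    ...   | inj₂ (inj₂ (inj₂ refl)) = ⊥-elim (d≢n (trans d≡pe (sym n≡p*[q*r])))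

    Π = ∏ᴸ P ds
    Ppq = P (p * q)
    Ppr = P (p * r)
    Pqr = P (q * r)
    Mpq = M (p * q)
    Mpr = M (p * r)
    Mqr = M (q * r)

    eqpq : P 1 ⋆ (P p ⋆ (P q ⋆ Ppq)) ≐ Mpq
    eqpq = P-pq pp pq p≢q spq
    eqpr : P 1 ⋆ (P p ⋆ (P r ⋆ Ppr)) ≐ Mpr
    eqpr = P-pq pp pr p≢r spr
    eqqr : P 1 ⋆ (P q ⋆ (P r ⋆ Pqr)) ≐ Mqr
    eqqr = P-pq pq pr q≢r sqr

    -- The factor Φ₁ Φ_r completes the seven polynomials to Φ_pq times all divisor factors of qr and
    -- all those of pr. The same equation yields `Ψ-factor` at the end.
    Π⋆M-r : Π ⋆ M r ≐ Ppq ⋆ (Mqr ⋆ Mpr)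
    Π⋆M-r = ≐-trans (⋆-cong ≐-refl (≐-sym (P-prime pr))) (≐-trans
      (solve 7 (λ a b c d e f g → (a :* (b :* (c :* (d :* (e :* (f :* (g :* con (+ 1)))))))) :* (a :* d) :=
          e :* ((a :* (c :* (d :* g))) :* (a :* (b :* (d :* f)))))
        ≐-refl (P 1) (P p) (P q) (P r) Ppq Ppr Pqr)
      (⋆-cong ≐-refl (⋆-cong eqqr eqpr)))

    Π⋆M-q : Π ⋆ M q ≐ Ppr ⋆ (Mqr ⋆ Mpq)
    Π⋆M-q = ≐-trans (⋆-cong ≐-refl (≐-sym (P-prime pq))) (≐-trans
      (solve 7 (λ a b c d e f g → (a :* (b :* (c :* (d :* (e :* (f :* (g :* con (+ 1)))))))) :* (a :* c) :=
          f :* ((a :* (c :* (d :* g))) :* (a :* (b :* (c :* e)))))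
        ≐-refl (P 1) (P p) (P q) (P r) Ppq Ppr Pqr)
      (⋆-cong ≐-refl (⋆-cong eqqr eqpq)))

    -- Φ_pq(x^r) and Φ_pr(x^q), the products of Φ_pqr with Φ_pq and Φ_pr.
    T₁ T₂ : Series
    T₁ = binary spq r
    T₂ = binary spr q

    T₁-M : T₁ ⋆ (Mqr ⋆ Mpr) ≐ M n ⋆ M r
    T₁-M = ≐-trans (⋆-cong ≐-refl (≐-trans (⋆-comm Mqr Mpr)
        (⋆-cong (M-≡ (ℕₚ.*-comm p r)) (M-≡ (ℕₚ.*-comm q r)))))
      (≐-trans (binary⋆M⋆M spq r) (⋆-cong (M-≡ (sym n≡r*[p*q])) ≐-refl))

    T₂-M : T₂ ⋆ (Mqr ⋆ Mpq) ≐ M n ⋆ M q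
    T₂-M = ≐-trans (⋆-cong ≐-refl (≐-trans (⋆-comm Mqr Mpq) (⋆-cong (M-≡ (ℕₚ.*-comm p q)) ≐-refl)))
      (≐-trans (binary⋆M⋆M spr q) (⋆-cong (M-≡ (sym n≡q*[p*r])) ≐-refl))

    Π⋆T₁ : Π ⋆ T₁ ≐ Ppq ⋆ M n
    Π⋆T₁ = M-cancel 0<r (begin
      Π ⋆ T₁ ⋆ M r
        ≈⟨ solve 3 (λ a b c → a :* b :* c := b :* (a :* c)) ≐-refl Π T₁ (M r) ⟩
      T₁ ⋆ (Π ⋆ M r)
        ≈⟨ ⋆-cong ≐-refl Π⋆M-r ⟩
      T₁ ⋆ (Ppq ⋆ (Mqr ⋆ Mpr))
        ≈⟨ solve 3 (λ a b c → a :* (b :* c) := b :* (a :* c)) ≐-refl T₁ Ppq (Mqr ⋆ Mpr) ⟩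
      Ppq ⋆ (T₁ ⋆ (Mqr ⋆ Mpr))
        ≈⟨ ⋆-cong ≐-refl T₁-M ⟩
      Ppq ⋆ (M n ⋆ M r)
        ≈⟨ ≐-sym (⋆-assoc Ppq (M n) (M r)) ⟩
      Ppq ⋆ M n ⋆ M r ∎)
      where open ≐-Reasoning

    Π⋆T₂ : Π ⋆ T₂ ≐ Ppr ⋆ M n
    Π⋆T₂ = M-cancel 0<q (begin
      Π ⋆ T₂ ⋆ M q
        ≈⟨ solve 3 (λ a b c → a :* b :* c := b :* (a :* c)) ≐-refl Π T₂ (M q) ⟩
      T₂ ⋆ (Π ⋆ M q)
        ≈⟨ ⋆-cong ≐-refl Π⋆M-q ⟩
      T₂ ⋆ (Ppr ⋆ (Mqr ⋆ Mpq))
        ≈⟨ solve 3 (λ a b c → a :* (b :* c) := b :* (a :* c)) ≐-refl T₂ Ppr (Mqr ⋆ Mpq) ⟩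
      Ppr ⋆ (T₂ ⋆ (Mqr ⋆ Mpq))
        ≈⟨ ⋆-cong ≐-refl T₂-M ⟩
      Ppr ⋆ (M n ⋆ M q)
        ≈⟨ ≐-sym (⋆-assoc Ppr (M n) (M q)) ⟩
      Ppr ⋆ M n ⋆ M q ∎)
      where open ≐-Reasoning

    A B : Series
    A = bézoutˡ sqr p
    B = bézoutʳ sqr p

    -- Φ_q Φ_pq and Φ_r Φ_pr are the quotients of x^(pq) - 1 and x^(pr) - 1 by x^p - 1, so this is
    -- `bézout-M` for q, r and d = p, divided by x^p - 1.
    bézout-P : A ⋆ (P q ⋆ Ppq) ⊕ B ⋆ (P r ⋆ Ppr) ≐ 𝟙
    bézout-P = M-cancel 0<p (begin
      (A ⋆ (P q ⋆ Ppq) ⊕ B ⋆ (P r ⋆ Ppr)) ⋆ M p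
        ≈⟨ ⋆-cong ≐-refl (≐-sym (P-prime pp)) ⟩
      (A ⋆ (P q ⋆ Ppq) ⊕ B ⋆ (P r ⋆ Ppr)) ⋆ (P 1 ⋆ P p)
        ≈⟨ solve 8 (λ a b x y z w u v → (a :* (x :* y) :+ b :* (z :* w)) :* (u :* v) :=
             a :* (u :* (v :* (x :* y))) :+ b :* (u :* (v :* (z :* w))))
             ≐-refl A B (P q) Ppq (P r) Ppr (P 1) (P p) ⟩
      A ⋆ (P 1 ⋆ (P p ⋆ (P q ⋆ Ppq))) ⊕ B ⋆ (P 1 ⋆ (P p ⋆ (P r ⋆ Ppr)))
        ≈⟨ ⊕-cong (⋆-cong (≐-refl {A}) eqpq) (⋆-cong (≐-refl {B}) eqpr) ⟩
      A ⋆ Mpq ⊕ B ⋆ Mpr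
        ≈⟨ bézout-M sqr p ⟩
      M p
        ≈⟨ ≐-sym (⋆-identityˡ (M p)) ⟩
      𝟙 ⋆ M p ∎)
      where open ≐-Reasoning

    -- Φ_pqr multiplied by the Bézout identity for Φ_pq and Φ_pr, which shows that it is a polynomial.
    S : Series
    S = A ⋆ (P q ⋆ T₁) ⊕ B ⋆ (P r ⋆ T₂)

    finite-S : Finite S
    finite-S = finite-⊕
      (finite-⋆ (finite-bézoutˡ sqr p) (finite-⋆ (finite-P q) (finite-binary spq r)))
      (finite-⋆ (finite-bézoutʳ sqr p)
        (finite-⋆ (finite-P r) (finite-binary spr q)))

    Π⋆S : Π ⋆ S ≐ M n
    Π⋆S = begin
      Π ⋆ S
        ≈⟨ solve 7 (λ π a b x y t u → π :* (a :* (x :* t) :+ b :* (y :* u)) :=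
             a :* (x :* (π :* t)) :+ b :* (y :* (π :* u)))
             ≐-refl Π A B (P q) (P r) T₁ T₂ ⟩
      A ⋆ (P q ⋆ (Π ⋆ T₁)) ⊕ B ⋆ (P r ⋆ (Π ⋆ T₂))
        ≈⟨ ⊕-cong (⋆-cong (≐-refl {A}) (⋆-cong (≐-refl {P q}) Π⋆T₁))
                  (⋆-cong (≐-refl {B}) (⋆-cong (≐-refl {P r}) Π⋆T₂)) ⟩
      A ⋆ (P q ⋆ (Ppq ⋆ M n)) ⊕ B ⋆ (P r ⋆ (Ppr ⋆ M n))
        ≈⟨ solve 7 (λ a b x y t u m → a :* (x :* (t :* m)) :+ b :* (y :* (u :* m)) :=
             (a :* (x :* t) :+ b :* (y :* u)) :* m)
             ≐-refl A B (P q) (P r) Ppq Ppr (M n) ⟩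
      (A ⋆ (P q ⋆ Ppq) ⊕ B ⋆ (P r ⋆ Ppr)) ⋆ M n
        ≈⟨ ⋆-cong bézout-P ≐-refl ⟩
      𝟙 ⋆ M n
        ≈⟨ ⋆-identityˡ (M n) ⟩
      M n ∎
      where open ≐-Reasoning

    0<n : 0 < n
    0<n = 0<r << r<pr << pr<qr << qr<n

    P-n : P n ≐ S
    P-n = Φ-exact n ds 0<n unique proper complete finite-S Π⋆S

    finite-∏ᴸ : ∀ es → Finite (∏ᴸ P es)
    finite-∏ᴸ [] = 1 , λ { (suc k) _ → refl }
    finite-∏ᴸ (e ∷ es) = finite-⋆ (finite-P e) (finite-∏ᴸ es)

    Ψ≐Π : ⟦ Ψ n ⟧ ≐ Π
    Ψ≐Π = exact 0<n
      (≐-trans (≐-sym Π⋆S) (≐-trans (⋆-comm Π S) (⋆-cong (≐-sym P-n) ≐-refl)))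
      where
      exact : ∀ {m} → 0 < m → M m ≐ P m ⋆ Π → ⟦ divMonic (xⁿ-1 m) (Φ m) ⟧ ≐ Π
      exact {suc m} _ e = divMonic-exact (xⁿ-1-monic m) (Φ-monic (suc m)) (proj₂ (finite-∏ᴸ ds))
        (≐-trans (⟦xⁿ-1⟧ (suc m)) e)

  Ψ-factor : ⟦ Ψ (p * q * r) ⟧ ≐ (X (r * q) ⊕ ⊖ 𝟙) ⋆ (geo r p ⋆ P (p * q))
  Ψ-factor = ≐-trans Ψ≐Π (M-cancel 0<r (begin
    Π ⋆ M r
      ≈⟨ Π⋆M-r ⟩
    Ppq ⋆ (Mqr ⋆ Mpr)
      ≈⟨ ⋆-cong ≐-refl (⋆-cong (M-≡ (ℕₚ.*-comm q r))
           (≐-trans (M-≡ (ℕₚ.*-comm p r)) (≐-sym (geo⋆M r p)))) ⟩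
    Ppq ⋆ (M (r * q) ⋆ (geo r p ⋆ M r))
      ≈⟨ solve 4 (λ a b c d → a :* (b :* (c :* d)) := b :* (c :* a) :* d)
           ≐-refl Ppq (M (r * q)) (geo r p) (M r) ⟩
    M (r * q) ⋆ (geo r p ⋆ Ppq) ⋆ M r ∎))
    where open ≐-Reasoning

-- Coefficients of Φ_pq

-- Membership is decided along with the value, so that reading a coefficient also delivers the grid
-- point behind it.
Indicator : Series → (ℕ → Set) → Set
Indicator F R = ∀ k → (R k × F k ≡ + 1) ⊎ (¬ R k × F k ≡ + 0)

indicator-X : ∀ n → Indicator (X n) (_≡ n)
indicator-X zero zero = inj₁ (refl , refl)
indicator-X zero (suc k) = inj₂ ((λ ()) , refl)
indicator-X (suc n) zero = inj₂ ((λ ()) , refl)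
indicator-X (suc n) (suc k) with indicator-X n k
... | inj₁ (e , x) = inj₁ (cong suc e , x)
... | inj₂ (ne , x) = inj₂ ((λ e → ne (ℕₚ.suc-injective e)) , x)

indicator-⊕ : ∀ {F G R S} → Indicator F R → Indicator G S → (∀ {k} → R k → S k → ⊥) →
  Indicator (F ⊕ G) (λ k → R k ⊎ S k)
indicator-⊕ iF iG disjoint k with iF k | iG k
... | inj₁ (x , _) | inj₁ (y , _) = ⊥-elim (disjoint x y)
... | inj₁ (x , e) | inj₂ (_ , e′) = inj₁ (inj₁ x , cong₂ ℤ._+_ e e′)
... | inj₂ (_ , e) | inj₁ (y , e′) = inj₁ (inj₂ y , cong₂ ℤ._+_ e e′)
... | inj₂ (x , e) | inj₂ (y , e′) = inj₂ ((λ { (inj₁ z) → x z ; (inj₂ z) → y z }) , cong₂ ℤ._+_ e e′)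

indicator-shift : ∀ n {F R} → Indicator F R → Indicator (X n ⋆ F) (λ k → ∃ λ l → k ≡ n + l × R l)
indicator-shift n {F} {R} iF k with n ≤? k
... | no h = inj₂ ((λ { (l , e , _) → h (subst (n ≤_) (sym e) (ℕₚ.m≤m+n n l)) }) ,
  X⋆-< n F (ℕₚ.≰⇒> h))
... | yes h with k ∸ n | ℕₚ.m+[n∸m]≡n h
...   | l | refl with iF l
...     | inj₁ (x , e) = inj₁ ((l , refl , x) , trans (X⋆-+ n F l) e)
...     | inj₂ (x , e) = inj₂ ((λ { (l′ , e′ , y) → x (subst R (sym (ℕₚ.+-cancelˡ-≡ n _ _ e′)) y) }) ,
    trans (X⋆-+ n F l) e)

indicator-map : ∀ {F G R S} → F ≐ G → (∀ {k} → R k → S k) → (∀ {k} → S k → R k) →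
  Indicator F R → Indicator G S
indicator-map e to from iF k with iF k
... | inj₁ (x , f) = inj₁ (to x , trans (sym (coeff e k)) f)
... | inj₂ (x , f) = inj₂ ((λ y → x (from y)) , trans (sym (coeff e k)) f)

Multiple : ℕ → ℕ → ℕ → Set
Multiple a m k = ∃ λ i → i < m × k ≡ a * i

indicator-geo : ∀ a m → 0 < a → Indicator (geo a m) (Multiple a m)
indicator-geo a zero _ k = inj₂ ((λ { (i , () , _) }) , refl)
indicator-geo a (suc m) 0<a = indicator-map ≐-refl to from
  (indicator-⊕ (indicator-geo a m 0<a) (indicator-X (a * m)) disjoint)
  where
  disjoint : ∀ {k} → Multiple a m k → k ≡ a * m → ⊥
  disjoint (i , i<m , refl) e =
    ℕₚ.<⇒≢ i<m (ℕₚ.*-cancelˡ-≡ i m a ⦃ ℕ.>-nonZero 0<a ⦄ e)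
  to : ∀ {k} → Multiple a m k ⊎ k ≡ a * m → Multiple a (suc m) k
  to (inj₁ (i , i<m , e)) = i , ℕₚ.m≤n⇒m≤1+n i<m , e
  to (inj₂ e) = m , ℕₚ.≤-refl , e
  from : ∀ {k} → Multiple a (suc m) k → Multiple a m k ⊎ k ≡ a * m
  from (i , s≤s i≤m , e) with ℕₚ.m≤n⇒m<n∨m≡n i≤m
  ... | inj₁ i<m = inj₁ (i , i<m , e)
  ... | inj₂ refl = inj₂ e

Grid : ℕ → ℕ → ℕ → ℕ → ℕ → Set
Grid a b m n k = ∃ λ i → ∃ λ j → i < m × j < n × k ≡ a * i + b * j

multiple-too-small : ∀ {a b} n → Coprime a b → 0 < n → n < a → ¬ (a ∣ b * n)
multiple-too-small {a} {b} (suc n) c _ n<a a∣ = ℕₚ.<⇒≱ n<a (∣⇒≤ (coprime-divisor c a∣))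

-- Equality would give a ∣ b (j′ - j) with 0 < j′ - j < a: fewer than a rows apart, rows lie in
-- different residue classes modulo a.
grid-rows-disjoint : ∀ {a b} i i′ {j j′} → Coprime a b → j < j′ → j′ < a →
  ¬ (a * i + b * j ≡ a * i′ + b * j′)
grid-rows-disjoint {a} {b} i i′ {j} {j′} c j<j′ j′<a e =
  multiple-too-small (j′ ∸ j) c (ℕₚ.m<n⇒0<n∸m j<j′) (ℕₚ.≤-<-trans (ℕₚ.m∸n≤m j′ j) j′<a)
    (∣m+n∣m⇒∣n (subst (a ∣_) a*i≡ (m∣m*n i)) (m∣m*n i′))
  where
  open ≡-Reasoning
  a*i≡ : a * i ≡ a * i′ + b * (j′ ∸ j)
  a*i≡ = ℕₚ.+-cancelʳ-≡ (b * j) _ _ (begin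
    a * i + b * j                              ≡⟨ e ⟩
    a * i′ + b * j′                            ≡⟨ cong (λ z → a * i′ + b * z) (sym (ℕₚ.m∸n+n≡m (ℕₚ.<⇒≤ j<j′))) ⟩
    a * i′ + b * (j′ ∸ j + j)                ≡⟨ cong (a * i′ ℕ.+_) (ℕₚ.*-distribˡ-+ b (j′ ∸ j) j) ⟩
    a * i′ + (b * (j′ ∸ j) + b * j)        ≡⟨ sym (ℕₚ.+-assoc (a * i′) _ _) ⟩
    a * i′ + b * (j′ ∸ j) + b * j ∎)

indicator-grid : ∀ {a b} m n → 0 < a → Coprime a b → n ≤ a →
  Indicator (geo a m ⋆ geo b n) (Grid a b m n)
indicator-grid {a} {b} m zero _ _ _ k =
  inj₂ ((λ { (_ , _ , _ , () , _) }) , trans (⋆-comm-at k (geo a m) 𝟘) (𝟘⋆-at k (geo a m)))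
indicator-grid {a} {b} m (suc n) 0<a c n<a = indicator-map series to from
  (indicator-⊕ (indicator-grid m n 0<a c (ℕₚ.<⇒≤ n<a))
    (indicator-shift (b * n) (indicator-geo a m 0<a)) disjoint)
  where
  Row : ℕ → Set
  Row k = ∃ λ l → k ≡ b * n + l × Multiple a m l
  series : geo a m ⋆ geo b n ⊕ X (b * n) ⋆ geo a m ≐ geo a m ⋆ geo b (suc n)
  series = solve 3 (λ g h x → g :* h :+ x :* g := g :* (h :+ x)) ≐-refl (geo a m) (geo b n) (X (b * n))
  disjoint : ∀ {k} → Grid a b m n k → Row k → ⊥
  disjoint (i , j , _ , j<n , refl) (_ , e , i′ , _ , refl) =
    grid-rows-disjoint i i′ c j<n n<a (trans e (ℕₚ.+-comm (b * n) (a * i′)))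
  to : ∀ {k} → Grid a b m n k ⊎ Row k → Grid a b m (suc n) k
  to (inj₁ (i , j , i<m , j<n , e)) = i , j , i<m , ℕₚ.m≤n⇒m≤1+n j<n , e
  to (inj₂ (_ , e , i , i<m , refl)) = i , n , i<m , ℕₚ.≤-refl , trans e (ℕₚ.+-comm (b * n) (a * i))
  from : ∀ {k} → Grid a b m (suc n) k → Grid a b m n k ⊎ Row k
  from (i , j , i<m , s≤s j≤n , e) with ℕₚ.m≤n⇒m<n∨m≡n j≤n
  ... | inj₁ j<n = inj₁ (i , j , i<m , j<n , e)
  ... | inj₂ refl = inj₂ (_ , trans e (ℕₚ.+-comm (a * i) (b * n)) , i , i<m , refl)

module BinaryCoefficients {a b} (1<a : 1 < a) (c : Coprime a b) (s : Split a b) where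
  open Split s

  Positive Negative : ℕ → Set
  Positive = Grid a b α γ
  Negative k = ∃ λ l → k ≡ 1 + l × Grid a b α′ γ′ l

  -- Adding a α′ and using 1 + a α′ = b γ moves a negative point from row j′ to row γ + j′ < a,
  -- while a positive point stays in its row j < γ.
  disjoint : ∀ {k} → Positive k → Negative k → ⊥
  disjoint (i , j , _ , j<γ , refl) (_ , e , i′ , j′ , _ , j′<γ′ , refl) =
    grid-rows-disjoint (i + α′) i′ c (ℕₚ.≤-trans j<γ (ℕₚ.m≤m+n γ j′))
      (subst (γ + j′ <_) (sym a≡) (ℕₚ.+-monoʳ-< γ j′<γ′)) (begin
      a * (i + α′) + b * j               ≡⟨ left a b i j α′ ⟩
      (a * i + b * j) + a * α′         ≡⟨ cong (_+ a * α′) e ⟩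
      1 + (a * i′ + b * j′) + a * α′ ≡⟨ right (a * i′) (b * j′) (a * α′) ⟩
      a * i′ + (suc (a * α′) + b * j′) ≡⟨ cong (λ z → a * i′ + (z + b * j′)) (sym b*γ≡) ⟩
      a * i′ + (b * γ + b * j′)        ≡⟨ cong (a * i′ ℕ.+_) (sym (ℕₚ.*-distribˡ-+ b γ j′)) ⟩
      a * i′ + b * (γ + j′) ∎)
    where
    open ≡-Reasoning
    left : ∀ a b i j x → a * (i + x) + b * j ≡ (a * i + b * j) + a * x
    left = ℕ-solve-∀
    right : ∀ x y z → 1 + (x + y) + z ≡ x + (suc z + y)
    right = ℕ-solve-∀

  private
    F = geo (1 * a) α ⋆ geo (1 * b) γ
    G = X 1 ⋆ (geo (1 * a) α′ ⋆ geo (1 * b) γ′)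

    0<a = ℕₚ.<⇒≤ 1<a

    geo-1* : ∀ m n → geo (1 * a) m ⋆ geo (1 * b) n ≐ geo a m ⋆ geo b n
    geo-1* m n rewrite ℕₚ.*-identityˡ a | ℕₚ.*-identityˡ b = ≐-refl

    F-indicator : Indicator F Positive
    F-indicator = indicator-map (≐-sym (geo-1* α γ)) (λ x → x) (λ x → x)
      (indicator-grid α γ 0<a c (subst (γ ≤_) (sym a≡) (ℕₚ.m≤m+n γ γ′)))

    G-indicator : Indicator G Negative
    G-indicator = indicator-map (⋆-cong ≐-refl (≐-sym (geo-1* α′ γ′))) (λ x → x) (λ x → x)
      (indicator-shift 1 (indicator-grid α′ γ′ 0<a c (subst (γ′ ≤_) (sym a≡) (ℕₚ.m≤n+m γ′ γ))))

  data Coefficient (k : ℕ) : ℤ → Set where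
    positive : Positive k → Coefficient k (+ 1)
    negative : Negative k → Coefficient k -[1+ 0 ]
    neither  : Coefficient k (+ 0)

  coefficient : ∀ k → Coefficient k (binary s 1 k)
  coefficient k with F-indicator k | G-indicator k
  ... | inj₁ (x , _) | inj₁ (y , _) = ⊥-elim (disjoint x y)
  ... | inj₁ (x , e) | inj₂ (_ , e′) rewrite e | e′ = positive x
  ... | inj₂ (_ , e) | inj₁ (y , e′) rewrite e | e′ = negative y
  ... | inj₂ (_ , e) | inj₂ (_ , e′) rewrite e | e′ = neither

  positive⇒1 : ∀ {k} → Positive k → binary s 1 k ≡ + 1
  positive⇒1 {k} x with F-indicator k | G-indicator k
  ... | inj₁ _ | inj₁ (y , _) = ⊥-elim (disjoint x y)
  ... | inj₁ (_ , e) | inj₂ (_ , e′) rewrite e | e′ = refl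
  ... | inj₂ (nx , _) | _ = ⊥-elim (nx x)

  negative⇒-1 : ∀ {k} → Negative k → binary s 1 k ≡ -[1+ 0 ]
  negative⇒-1 {k} y with F-indicator k | G-indicator k
  ... | inj₁ (x , _) | _ = ⊥-elim (disjoint x y)
  ... | inj₂ (_ , e) | inj₁ (_ , e′) rewrite e | e′ = refl
  ... | inj₂ _ | inj₂ (ny , _) = ⊥-elim (ny y)

  grid-bound : ∀ {m n k} → Grid a b m n k → k + (a + b) ≤ a * m + b * n
  grid-bound {m} {n} (i , j , i<m , j<n , refl) = ℕₚ.≤-trans (ℕₚ.≤-reflexive (collect a b i j))
    (ℕₚ.+-mono-≤ (ℕₚ.*-monoʳ-≤ a i<m) (ℕₚ.*-monoʳ-≤ b j<n))
    where
    collect : ∀ a b i j → a * i + b * j + (a + b) ≡ a * suc i + b * suc j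
    collect = ℕ-solve-∀

  -- The bound k ≤ (a - 1)(b - 1), written without subtraction.
  degree-bound : ∀ {k z} → Coefficient k z → ¬ (z ≡ + 0) → k + (a + b) ≤ suc (a * b)
  degree-bound (positive g) _ = ℕₚ.≤-trans (grid-bound g) (ℕₚ.≤-reflexive (begin
    a * α + b * γ                 ≡⟨ cong₂ _+_ a*α≡ b*γ≡ ⟩
    suc (b * γ′) + suc (a * α′)   ≡⟨ ℕₚ.+-suc (suc (b * γ′)) (a * α′) ⟩
    suc (suc (b * γ′ + a * α′))   ≡⟨ cong suc (sym a*b≡) ⟩
    suc (a * b) ∎))
    where open ≡-Reasoning
  degree-bound (negative (_ , refl , g)) _ = s≤s (ℕₚ.≤-trans (grid-bound g)
    (ℕₚ.≤-trans (ℕₚ.≤-reflexive (ℕₚ.+-comm (a * α′) (b * γ′)))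
      (ℕₚ.≤-trans (ℕₚ.n≤1+n _) (ℕₚ.≤-reflexive (sym a*b≡)))))
  degree-bound neither 0≢0 = ⊥-elim (0≢0 refl)

-- Sums of coefficients bounded by one

sumℤ-zero : ∀ n {f} → (∀ i → i < n → f i ≡ + 0) → sumℤ n f ≡ + 0
sumℤ-zero zero _ = refl
sumℤ-zero (suc n) e = cong₂ ℤ._+_ (sumℤ-zero n λ i i<n → e i (ℕₚ.m≤n⇒m≤1+n i<n)) (e n ℕₚ.≤-refl)

sumℤ-neg : ∀ n f → sumℤ n (λ i → ℤ.- f i) ≡ ℤ.- sumℤ n f
sumℤ-neg zero f = refl
sumℤ-neg (suc n) f = trans (cong (ℤ._+ ℤ.- f n) (sumℤ-neg n f)) (sym (ℤₚ.neg-distrib-+ (sumℤ n f) (f n)))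

sumℤ-≤ : ∀ n {f} → (∀ i → f i ℤ.≤ + 1) → sumℤ n f ℤ.≤ + n
sumℤ-≤ zero _ = ℤₚ.≤-refl
sumℤ-≤ (suc n) {f} h = ℤₚ.≤-trans (ℤₚ.+-mono-≤ (sumℤ-≤ n h) (h n))
  (ℤₚ.≤-reflexive (cong +_ (ℕₚ.+-comm n 1)))

ℤ-+-cancelˡ-≤ : ∀ a {b c} → a ℤ.+ b ℤ.≤ a ℤ.+ c → b ℤ.≤ c
ℤ-+-cancelˡ-≤ a {b} {c} h = ℤₚ.≤-trans (ℤₚ.≤-reflexive (sym (cancel a b)))
  (ℤₚ.≤-trans (ℤₚ.+-monoʳ-≤ (ℤ.- a) h) (ℤₚ.≤-reflexive (cancel a c)))
  where
  cancel : ∀ a b → ℤ.- a ℤ.+ (a ℤ.+ b) ≡ b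
  cancel = ℤ-solve-∀

sumℤ-max : ∀ n {f} → (∀ i → f i ℤ.≤ + 1) → sumℤ n f ≡ + n → ∀ i → i < n → f i ≡ + 1
sumℤ-max (suc n) {f} h e i (s≤s i≤n) with ℕₚ.m≤n⇒m<n∨m≡n i≤n
... | inj₂ refl = ℤₚ.≤-antisym (h n) (ℤ-+-cancelˡ-≤ (+ n) (ℤₚ.≤-trans
  (ℤₚ.≤-reflexive (trans (cong +_ (ℕₚ.+-comm n 1)) (sym e))) (ℤₚ.+-monoˡ-≤ (f n) (sumℤ-≤ n h))))
... | inj₁ i<n = sumℤ-max n h (ℤₚ.≤-antisym (sumℤ-≤ n h) n≤) i i<n
  where
  n≤ : + n ℤ.≤ sumℤ n f
  n≤ = ℤ-+-cancelˡ-≤ (+ 1) (ℤₚ.≤-trans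
    (ℤₚ.≤-reflexive (sym e)) (ℤₚ.≤-trans (ℤₚ.+-monoʳ-≤ (sumℤ n f) (h n))
      (ℤₚ.≤-reflexive (ℤₚ.+-comm (sumℤ n f) (+ 1)))))

∣∣≤ : ∀ {z n} → z ℤ.≤ + n → ℤ.- z ℤ.≤ + n → ℤ.∣ z ∣ ≤ n
∣∣≤ {+ m} h _ = ℤₚ.drop‿+≤+ h
∣∣≤ { -[1+ m ]} _ h = ℤₚ.drop‿+≤+ h

∣∣≡ : ∀ {z n} → ℤ.∣ z ∣ ≡ n → z ≡ + n ⊎ ℤ.- z ≡ + n
∣∣≡ {+ m} refl = inj₁ refl
∣∣≡ { -[1+ m ]} refl = inj₂ refl

data Sign : ℤ → Set where
  plus  : Sign (+ 1)
  minus : Sign -[1+ 0 ]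

sign≢0 : ∀ {ε} → Sign ε → ¬ (ε ≡ + 0)
sign≢0 plus ()
sign≢0 minus ()

sign-neg : ∀ {ε} → Sign ε → Sign (ℤ.- ε)
sign-neg plus = minus
sign-neg minus = plus

SmallSeries : Series → Set
SmallSeries f = ∀ k → f k ≡ + 0 ⊎ Sign (f k)

shift-small : ∀ {f} → SmallSeries f → ∀ n → SmallSeries (X n ⋆ f)
shift-small {f} small n k with n ≤? k
... | no h = inj₁ (X⋆-< n f (ℕₚ.≰⇒> h))
... | yes h rewrite sym (ℕₚ.m+[n∸m]≡n h) | X⋆-+ n f (k ∸ n) = small (k ∸ n)

small-≤1 : ∀ {z} → z ≡ + 0 ⊎ Sign z → z ℤ.≤ + 1
small-≤1 (inj₁ refl) = ℤ.+≤+ z≤n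
small-≤1 (inj₂ plus) = ℤₚ.≤-refl
small-≤1 (inj₂ minus) = ℤ.-≤+

small-neg : ∀ {z} → z ≡ + 0 ⊎ Sign z → ℤ.- z ≡ + 0 ⊎ Sign (ℤ.- z)
small-neg (inj₁ refl) = inj₁ refl
small-neg (inj₂ s) = inj₂ (sign-neg s)

-- With D bounding the degree of f, this s is the first translate f x^(rs) that can reach up to
-- degree k; all earlier ones vanish there.
least-cover : ∀ r D k N → k ≤ r * N + D →
  ∃ λ s → k ≤ r * s + D × (∀ i → i < s → r * i + D < k)
least-cover r D k zero h = 0 , h , λ _ ()
least-cover r D k (suc N) h with k ≤? r * N + D
... | yes h′ = least-cover r D k N h′
... | no h′ = suc N , h , λ { i (s≤s i≤N) →
  ℕₚ.≤-<-trans (ℕₚ.+-monoˡ-≤ D (ℕₚ.*-monoʳ-≤ r i≤N)) (ℕₚ.≰⇒> h′) }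

-- A polynomial f of degree at most (p - 1)(q - 1) < (p - 1) r meets at most p - 1 of its translates
-- f x^(rs) in any given degree. The translates in (x^(qr) - 1)(1 + x^r + … + x^((p-1)r)) f have
-- s < p (sign -) or q ≤ s < q + p (sign +), and p < q keeps these two blocks apart, so that p - 1
-- consecutive translates lie in one of them.
module Window (L q₁ r : ℕ) (p<q : suc (suc L) < suc q₁) (q₁<r : q₁ < r)
              (f : Series) (small : SmallSeries f)
              (degree≤ : ∀ k → ¬ (f k ≡ + 0) → k ≤ suc L * q₁) where

  p q D : ℕ
  p = suc (suc L)
  q = suc q₁
  D = suc L * q₁

  ψ : Series
  ψ = (X (r * q) ⊕ ⊖ 𝟙) ⋆ (geo r p ⋆ f)

  t : ℕ → ℕ → ℤ
  t k s = (X (r * s) ⋆ f) k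

  geo-sum : ∀ n k → (geo r n ⋆ f) k ≡ sumℤ n (t k)
  geo-sum zero k = 𝟘⋆-at k f
  geo-sum (suc n) k = trans (⋆-distribʳ-at k (geo r n) (X (r * n)) f)
    (cong (ℤ._+ t k n) (geo-sum n k))

  X⋆geo-sum : ∀ n k → (X (r * q) ⋆ (geo r n ⋆ f)) k ≡ sumℤ n (λ s → t k (q + s))
  X⋆geo-sum zero k = trans (⋆-cong-at k (≐-refl {X (r * q)}) (pointwise λ i → 𝟘⋆-at i f))
    (trans (⋆-comm-at k (X (r * q)) 𝟘) (𝟘⋆-at k (X (r * q))))
  X⋆geo-sum (suc n) k = trans
    (coeff (solve 4 (λ x g y f → x :* ((g :+ y) :* f) := x :* (g :* f) :+ (x :* y) :* f)
      ≐-refl (X (r * q)) (geo r n) (X (r * n)) f) k)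
    (cong₂ ℤ._+_ (X⋆geo-sum n k) (⋆-cong-at k
      (≐-trans (X-+ (r * q) (r * n)) (X-≡ (sym (ℕₚ.*-distribˡ-+ r q n)))) ≐-refl))

  ψ-sum : ∀ k → ψ k ≡ sumℤ p (λ s → t k (q + s)) ℤ.- sumℤ p (t k)
  ψ-sum k = trans
    (coeff (solve 2 (λ x h → (x :+ :- con (+ 1)) :* h := x :* h :+ :- h)
      ≐-refl (X (r * q)) (geo r p ⋆ f)) k)
    (cong₂ ℤ._-_ (X⋆geo-sum p k) (geo-sum p k))

  t-zero : ∀ {k s} → k < r * s → t k s ≡ + 0
  t-zero {s = s} = X⋆-< (r * s) f

  t-at : ∀ s l → t (r * s + l) s ≡ f l
  t-at s l = X⋆-+ (r * s) f l

  t-nonzero : ∀ {k s} → ¬ (t k s ≡ + 0) → ∃ λ l → k ≡ r * s + l × t k s ≡ f l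
  t-nonzero {k} {s} nz with r * s ≤? k
  ... | no h = ⊥-elim (nz (t-zero {k} {s} (ℕₚ.≰⇒> h)))
  ... | yes h = k ∸ r * s , sym (ℕₚ.m+[n∸m]≡n h) ,
    trans (cong (λ z → t z s) (sym (ℕₚ.m+[n∸m]≡n h))) (t-at s (k ∸ r * s))

  module _ (k : ℕ) where

    -- Both blocks merged into one signed sequence, from which a window of consecutive indices can
    -- be cut wherever it falls.
    v : ℕ → ℤ
    v s with s <? p | s <? q | s <? q + p
    ... | yes _ | _ | _ = ℤ.- t k s
    ... | no _ | yes _ | _ = + 0
    ... | no _ | no _ | yes _ = t k s
    ... | no _ | no _ | no _ = + 0

    v-low : ∀ s → s < p → v s ≡ ℤ.- t k s
    v-low s h with s <? p | s <? q | s <? q + p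
    ... | yes _ | _ | _ = refl
    ... | no h′ | _ | _ = ⊥-elim (h′ h)

    v-middle : ∀ s → p ≤ s → s < q → v s ≡ + 0
    v-middle s h h′ with s <? p | s <? q | s <? q + p
    ... | yes a | _ | _ = ⊥-elim (ℕₚ.<⇒≱ a h)
    ... | no _ | yes _ | _ = refl
    ... | no _ | no b | _ = ⊥-elim (b h′)

    v-high : ∀ s → q ≤ s → s < q + p → v s ≡ t k s
    v-high s h h′ with s <? p | s <? q | s <? q + p
    ... | yes a | _ | _ = ⊥-elim (ℕₚ.<⇒≱ (ℕₚ.<-trans a p<q) h)
    ... | no _ | yes b | _ = ⊥-elim (ℕₚ.<⇒≱ b h)
    ... | no _ | no _ | yes _ = refl
    ... | no _ | no _ | no c = ⊥-elim (c h′)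

    v-out : ∀ s → q + p ≤ s → v s ≡ + 0
    v-out s h with s <? p | s <? q | s <? q + p
    ... | yes a | _ | _ = ⊥-elim (ℕₚ.<⇒≱ a (ℕₚ.≤-trans (ℕₚ.m≤n+m p q) h))
    ... | no _ | yes b | _ = refl
    ... | no _ | no _ | yes c = ⊥-elim (ℕₚ.<⇒≱ c h)
    ... | no _ | no _ | no _ = refl

    v-small : ∀ s → v s ≡ + 0 ⊎ Sign (v s)
    v-small s with s <? p | s <? q | s <? q + p
    ... | yes _ | _ | _ = small-neg (shift-small small (r * s) k)
    ... | no _ | yes _ | _ = inj₁ refl
    ... | no _ | no _ | yes _ = shift-small small (r * s) k
    ... | no _ | no _ | no _ = inj₁ refl

    v-zero : ∀ s → t k s ≡ + 0 → v s ≡ + 0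
    v-zero s e with s <? p | s <? q | s <? q + p
    ... | yes _ | _ | _ = cong ℤ.-_ e
    ... | no _ | yes _ | _ = refl
    ... | no _ | no _ | yes _ = e
    ... | no _ | no _ | no _ = refl

    v-nonzero : ∀ s → ¬ (v s ≡ + 0) → (s < p × v s ≡ ℤ.- t k s) ⊎ (q ≤ s × v s ≡ t k s)
    v-nonzero s nz with s <? p | s <? q | s <? q + p
    ... | yes a | _ | _ = inj₁ (a , refl)
    ... | no _ | yes _ | _ = ⊥-elim (nz refl)
    ... | no _ | no b | yes _ = inj₂ (ℕₚ.≮⇒≥ b , refl)
    ... | no _ | no _ | no _ = ⊥-elim (nz refl)

    -- E pads the range with zeros so that it also contains the window.
    v-sum : ∀ E → sumℤ (q + p + E) v ≡ ψ k
    v-sum E = begin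
      sumℤ (q + p + E) v
        ≡⟨ sumℤ-+ (q + p) E v ⟩
      sumℤ (q + p) v ℤ.+ sumℤ E (λ i → v (q + p + i))
        ≡⟨ cong₂ ℤ._+_ (sumℤ-+ q p v) (sumℤ-zero E λ i _ → v-out _ (ℕₚ.m≤m+n _ i)) ⟩
      sumℤ q v ℤ.+ sumℤ p (λ i → v (q + i)) ℤ.+ + 0
        ≡⟨ ℤₚ.+-identityʳ _ ⟩
      sumℤ q v ℤ.+ sumℤ p (λ i → v (q + i))
        ≡⟨ cong₂ ℤ._+_ lower (sumℤ-cong p λ i i<p → v-high _ (ℕₚ.m≤m+n q i) (ℕₚ.+-monoʳ-< q i<p)) ⟩
      ℤ.- sumℤ p (t k) ℤ.+ sumℤ p (λ s → t k (q + s))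
        ≡⟨ ℤₚ.+-comm (ℤ.- sumℤ p (t k)) _ ⟩
      sumℤ p (λ s → t k (q + s)) ℤ.- sumℤ p (t k)
        ≡⟨ sym (ψ-sum k) ⟩
      ψ k ∎
      where
      open ≡-Reasoning
      p+[q∸p]≡q : p + (q ∸ p) ≡ q
      p+[q∸p]≡q = ℕₚ.m+[n∸m]≡n (ℕₚ.<⇒≤ p<q)
      lower : sumℤ q v ≡ ℤ.- sumℤ p (t k)
      lower = begin
        sumℤ q v
          ≡⟨ cong (λ z → sumℤ z v) (sym p+[q∸p]≡q) ⟩
        sumℤ (p + (q ∸ p)) v
          ≡⟨ sumℤ-+ p (q ∸ p) v ⟩
        sumℤ p v ℤ.+ sumℤ (q ∸ p) (λ i → v (p + i))
          ≡⟨ cong₂ ℤ._+_ (trans (sumℤ-cong p v-low) (sumℤ-neg p (t k)))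
               (sumℤ-zero (q ∸ p) λ i i< → v-middle _ (ℕₚ.m≤m+n p i)
                 (subst (p + i <_) p+[q∸p]≡q (ℕₚ.+-monoʳ-< p i<))) ⟩
        ℤ.- sumℤ p (t k) ℤ.+ + 0
          ≡⟨ ℤₚ.+-identityʳ _ ⟩
        ℤ.- sumℤ p (t k) ∎

    private
      0<r : 0 < r
      0<r = ℕₚ.≤-<-trans z≤n q₁<r

      cover = least-cover r D k k
        (ℕₚ.≤-trans (ℕₚ.m≤n*m k r ⦃ ℕ.>-nonZero 0<r ⦄) (ℕₚ.m≤m+n (r * k) D))

      s₁ : ℕ
      s₁ = proj₁ cover

      t-below : ∀ s → s < s₁ → t k s ≡ + 0
      t-below s s<s₁ with t k s ℤ.≟ + 0
      ... | yes e = e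
      ... | no nz with t-nonzero {k} {s} nz
      ...   | l , k≡ , e = ⊥-elim (ℕₚ.<⇒≱ (proj₂ (proj₂ cover) s s<s₁)
        (ℕₚ.≤-trans (ℕₚ.≤-reflexive k≡)
          (ℕₚ.+-monoʳ-≤ (r * s) (degree≤ l λ fl≡0 → nz (trans e fl≡0)))))

      -- The choice of s₁ gives k ≤ r s₁ + (p - 1)(q - 1) < r (s₁ + p - 1), so these translates
      -- start above degree k.
      t-above : ∀ i → t k (s₁ + suc L + i) ≡ + 0
      t-above i = t-zero {k} {s₁ + suc L + i} (begin-strict
        k                                  ≤⟨ proj₁ (proj₂ cover) ⟩
        r * s₁ + suc L * q₁          <⟨ ℕₚ.+-monoʳ-< (r * s₁) (ℕₚ.*-monoʳ-< (suc L) q₁<r) ⟩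
        r * s₁ + suc L * r           ≡⟨ cong (r * s₁ ℕ.+_) (ℕₚ.*-comm (suc L) r) ⟩
        r * s₁ + r * suc L           ≡⟨ sym (ℕₚ.*-distribˡ-+ r s₁ (suc L)) ⟩
        r * (s₁ + suc L)               ≤⟨ ℕₚ.*-monoʳ-≤ r (ℕₚ.m≤m+n (s₁ + suc L) i) ⟩
        r * (s₁ + suc L + i) ∎)
        where open ℕₚ.≤-Reasoning

      ψ-window : ψ k ≡ sumℤ (suc L) (λ i → v (s₁ + i))
      ψ-window = begin
        ψ k
          ≡⟨ sym (v-sum (s₁ + suc L)) ⟩
        sumℤ (q + p + (s₁ + suc L)) v
          ≡⟨ cong (λ z → sumℤ z v) (ℕₚ.+-comm (q + p) (s₁ + suc L)) ⟩
        sumℤ (s₁ + suc L + (q + p)) v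
          ≡⟨ sumℤ-+ (s₁ + suc L) (q + p) v ⟩
        sumℤ (s₁ + suc L) v ℤ.+ sumℤ (q + p) (λ i → v (s₁ + suc L + i))
          ≡⟨ cong₂ ℤ._+_ (sumℤ-+ s₁ (suc L) v)
               (sumℤ-zero (q + p) λ i _ → v-zero (s₁ + suc L + i) (t-above i)) ⟩
        sumℤ s₁ v ℤ.+ sumℤ (suc L) (λ i → v (s₁ + i)) ℤ.+ + 0
          ≡⟨ ℤₚ.+-identityʳ _ ⟩
        sumℤ s₁ v ℤ.+ sumℤ (suc L) (λ i → v (s₁ + i))
          ≡⟨ cong (ℤ._+ sumℤ (suc L) (λ i → v (s₁ + i)))
               (sumℤ-zero s₁ λ i i<s₁ → v-zero i (t-below i i<s₁)) ⟩
        + 0 ℤ.+ sumℤ (suc L) (λ i → v (s₁ + i))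
          ≡⟨ ℤₚ.+-identityˡ _ ⟩
        sumℤ (suc L) (λ i → v (s₁ + i)) ∎
        where open ≡-Reasoning

      -ψ-window : ℤ.- ψ k ≡ sumℤ (suc L) (λ i → ℤ.- v (s₁ + i))
      -ψ-window = trans (cong ℤ.-_ ψ-window) (sym (sumℤ-neg (suc L) _))

      v≤1 : ∀ i → v (s₁ + i) ℤ.≤ + 1
      v≤1 i = small-≤1 (v-small (s₁ + i))

      -v≤1 : ∀ i → ℤ.- v (s₁ + i) ℤ.≤ + 1
      -v≤1 i = small-≤1 (small-neg (v-small (s₁ + i)))

    ∣ψ∣≤ : ℤ.∣ ψ k ∣ ≤ suc L
    ∣ψ∣≤ = ∣∣≤ (subst (ℤ._≤ + suc L) (sym ψ-window) (sumℤ-≤ (suc L) v≤1))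
              (subst (ℤ._≤ + suc L) (sym -ψ-window) (sumℤ-≤ (suc L) -v≤1))

    private
      constant : ℤ.∣ ψ k ∣ ≡ suc L → ∃ λ ε → Sign ε × (∀ i → i ≤ L → v (s₁ + i) ≡ ε)
      constant e with ∣∣≡ {ψ k} e
      ... | inj₁ e′ = + 1 , plus , λ i i≤L →
        sumℤ-max (suc L) v≤1 (trans (sym ψ-window) e′) i (s≤s i≤L)
      ... | inj₂ e′ = -[1+ 0 ] , minus , λ i i≤L → trans (sym (ℤₚ.neg-involutive _)) (cong ℤ.-_
        (sumℤ-max (suc L) -v≤1 (trans (sym -ψ-window) e′) i (s≤s i≤L)))

      translates : ℤ.∣ ψ k ∣ ≡ suc L → ∃ λ ε → Sign ε × (∀ i → i ≤ L → t k (s₁ + i) ≡ ε)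
      translates e with constant e
      ... | ε , sgn , v≡ with v-nonzero (s₁ + 0) (λ z → sign≢0 sgn (trans (sym (v≡ 0 z≤n)) z))
      ...   | inj₁ (s₁<p , _) = ℤ.- ε , sign-neg sgn , λ i i≤L →
        trans (sym (ℤₚ.neg-involutive _)) (cong ℤ.-_ (trans (sym (v-low _ (low i i≤L))) (v≡ i i≤L)))
        where
        -- One step from an index below p reaches at most p < q, which is short of the second block.
        low : ∀ i → i ≤ L → s₁ + i < p
        low zero _ = s₁<p
        low (suc i) i<L with v-nonzero (s₁ + suc i) (λ z → sign≢0 sgn (trans (sym (v≡ (suc i) i<L)) z))
        ... | inj₁ (h , _) = h
        ... | inj₂ (h , _) = ⊥-elim (ℕₚ.<⇒≱ p<q (ℕₚ.≤-trans h
          (subst (_≤ p) (sym (ℕₚ.+-suc s₁ i)) (low i (ℕₚ.<⇒≤ i<L)))))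
      ...   | inj₂ (q≤s₁ , _) = ε , sgn , λ i i≤L → high i i≤L
        where
        high : ∀ i → i ≤ L → t k (s₁ + i) ≡ ε
        high i i≤L with v-nonzero (s₁ + i) (λ z → sign≢0 sgn (trans (sym (v≡ i i≤L)) z))
        ... | inj₂ (_ , e) = trans (sym e) (v≡ i i≤L)
        ... | inj₁ (h , _) = ⊥-elim (ℕₚ.<⇒≱ (ℕₚ.<-trans h p<q)
          (ℕₚ.≤-trans q≤s₁ (ℕₚ.+-monoʳ-≤ s₁ z≤n)))

    progression : ℤ.∣ ψ k ∣ ≡ suc L →
      ∃ λ ε → Sign ε × ∃ λ m → ∀ j → j ≤ L → f (m + r * j) ≡ ε
    progression e with translates e
    -- Larger shifts read lower coefficients of f: the last translate supplies the lowest degree m,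
    -- and the order is reversed.
    ... | ε , sgn , t≡ with t-nonzero {k} {s₁ + L} (λ z → sign≢0 sgn (trans (sym (t≡ L ℕₚ.≤-refl)) z))
    ...   | m , k≡ , _ = ε , sgn , m , λ j j≤L → begin
      f (m + r * j)
        ≡⟨ sym (t-at (s₁ + (L ∸ j)) (m + r * j)) ⟩
      t (r * (s₁ + (L ∸ j)) + (m + r * j)) (s₁ + (L ∸ j))
        ≡⟨ cong (λ z → t z (s₁ + (L ∸ j))) (trans (regroup r s₁ (L ∸ j) m j)
             (trans (cong (λ z → r * (s₁ + z) + m) (ℕₚ.m∸n+n≡m j≤L)) (sym k≡))) ⟩
      t k (s₁ + (L ∸ j))
        ≡⟨ t≡ (L ∸ j) (ℕₚ.m∸n≤m L j) ⟩
      ε ∎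
      where
      open ≡-Reasoning
      regroup : ∀ r s x m j → r * (s + x) + (m + r * j) ≡ r * (s + (x + j)) + m
      regroup = ℕ-solve-∀

  -- In degree c + r L the translates s ≤ L contribute ε each. Those with s > L start above this
  -- degree since c < r; this covers the whole second block, as q > L.
  attained : ∀ {ε c} → Sign ε → c < r → (∀ j → j ≤ L → f (c + r * j) ≡ ε) →
    ℤ.∣ ψ (c + r * L) ∣ ≡ suc L
  attained {ε} {c} sgn c<r f≡ = trans (cong ℤ.∣_∣ (begin
    ψ k
      ≡⟨ ψ-sum k ⟩
    sumℤ p (λ s → t k (q + s)) ℤ.- (sumℤ (suc L) (t k) ℤ.+ t k (suc L))
      ≡⟨ cong₂ ℤ._-_
           (sumℤ-zero p λ s _ → beyond (q + s) (ℕₚ.≤-trans (ℕₚ.<⇒≤ (ℕₚ.≤-<-trans (ℕₚ.n≤1+n _) p<q)) (ℕₚ.m≤m+n q s)))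
           (cong₂ ℤ._+_ (sumℤ-cong (suc L) λ { s (s≤s s≤L) → within s s≤L }) (beyond (suc L) ℕₚ.≤-refl)) ⟩
    + 0 ℤ.- (sumℤ (suc L) (λ _ → ε) ℤ.+ + 0)
      ≡⟨ trans (ℤₚ.+-identityˡ _) (cong ℤ.-_ (ℤₚ.+-identityʳ _)) ⟩
    ℤ.- sumℤ (suc L) (λ _ → ε) ∎))
    (trans (ℤₚ.∣-i∣≡∣i∣ (sumℤ (suc L) λ _ → ε)) (∣sum-sign∣ sgn (suc L)))
    where
    open ≡-Reasoning
    k = c + r * L
    beyond : ∀ s → suc L ≤ s → t k s ≡ + 0
    beyond s L<s = t-zero {k} {s} (ℕₚ.<-≤-trans (ℕₚ.+-monoˡ-< (r * L) c<r)
      (ℕₚ.≤-trans (ℕₚ.≤-reflexive (sym (ℕₚ.*-suc r L))) (ℕₚ.*-monoʳ-≤ r L<s)))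
    within : ∀ s → s ≤ L → t k s ≡ ε
    within s s≤L = trans (cong (λ z → t z s) (trans
        (cong (λ z → c + r * z) (sym (ℕₚ.m∸n+n≡m s≤L))) (regroup c r (L ∸ s) s)))
      (trans (t-at s (c + r * (L ∸ s))) (f≡ (L ∸ s) (ℕₚ.m∸n≤m L s)))
      where
      regroup : ∀ c r x s → c + r * (x + s) ≡ r * s + (c + r * x)
      regroup = ℕ-solve-∀
    sum-1 : ∀ n → sumℤ n (λ _ → + 1) ≡ + n
    sum-1 zero = refl
    sum-1 (suc n) = trans (cong (ℤ._+ + 1) (sum-1 n)) (cong +_ (ℕₚ.+-comm n 1))
    ∣sum-sign∣ : ∀ {ε} → Sign ε → ∀ n → ℤ.∣ sumℤ n (λ _ → ε) ∣ ≡ n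
    ∣sum-sign∣ plus n = cong ℤ.∣_∣ (sum-1 n)
    ∣sum-sign∣ minus n = trans (cong ℤ.∣_∣ (sumℤ-neg n (λ _ → + 1)))
      (trans (ℤₚ.∣-i∣≡∣i∣ (sumℤ n λ _ → + 1)) (cong ℤ.∣_∣ (sum-1 n)))

-- A progression m, m + r, …, m + L r in the grid has pairwise distinct rows, hence at least L + 1 of
-- them; as the columns are then narrower than r, its rows increase and so start with 0 and 1.
module GridProgression {L p q r m c M N : ℕ} (p≡ : p ≡ suc (suc L)) (0<L : 0 < L)
    (p⊥r : Coprime p r) (q<r : q < r) (N≤ : N ≤ suc L) (narrow : N ≡ suc L → p * M ≤ suc q)
    (progression : ∀ j → j ≤ L → ∃ λ l → m + r * j ≡ c + l × Grid p q M N l) where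

  Row : ℕ → ℕ → Set
  Row j y = ∃ λ i → i < M × y < N × m + r * j ≡ c + (p * i + q * y)

  row : ∀ j → j ≤ L → ∃ (Row j)
  row j j≤L with progression j j≤L
  ... | _ , e , i , y , i<M , y<N , refl = y , i , i<M , y<N , e

  -- Two members in one row differ by a multiple of p, so p would divide r (j′ - j) although 0 < j′
  -- - j < p.
  rows-distinct : ∀ {j j′ y} → j < j′ → j′ ≤ L → Row j y → ¬ Row j′ y
  rows-distinct {j} {j′} {y} j<j′ j′≤L (i , _ , _ , e) (i′ , _ , _ , e′) =
    multiple-too-small (j′ ∸ j) p⊥r (ℕₚ.m<n⇒0<n∸m j<j′)
      (ℕₚ.≤-<-trans (ℕₚ.m∸n≤m j′ j) (subst (j′ <_) (sym p≡) (s≤s (ℕₚ.m≤n⇒m≤1+n j′≤L))))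
      (∣m+n∣m⇒∣n (subst (p ∣_) (sym p*i′≡) (m∣m*n i′)) (m∣m*n i))
    where
    open ≡-Reasoning
    p*i′≡ : p * i + r * (j′ ∸ j) ≡ p * i′
    p*i′≡ = ℕₚ.+-cancelʳ-≡ (c + q * y) _ _ (begin
      p * i + r * (j′ ∸ j) + (c + q * y)
        ≡⟨ rearrange (p * i) (r * (j′ ∸ j)) c (q * y) ⟩
      c + (p * i + q * y) + r * (j′ ∸ j)
        ≡⟨ cong (_+ r * (j′ ∸ j)) (sym e) ⟩
      m + r * j + r * (j′ ∸ j)
        ≡⟨ collect m r j (j′ ∸ j) ⟩
      m + r * (j + (j′ ∸ j))
        ≡⟨ cong (λ z → m + r * z) (ℕₚ.m+[n∸m]≡n (ℕₚ.<⇒≤ j<j′)) ⟩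
      m + r * j′
        ≡⟨ e′ ⟩
      c + (p * i′ + q * y)
        ≡⟨ swap c (p * i′) (q * y) ⟩
      p * i′ + (c + q * y) ∎)
      where
      rearrange : ∀ a b c d → a + b + (c + d) ≡ c + (a + d) + b
      rearrange = ℕ-solve-∀
      collect : ∀ m r j d → m + r * j + r * d ≡ m + r * (j + d)
      collect = ℕ-solve-∀
      swap : ∀ a b c → a + (b + c) ≡ b + (a + c)
      swap = ℕ-solve-∀

  rowOf : Fin (suc L) → Fin N
  rowOf j with row (toℕ j) (toℕ≤pred[n] j)
  ... | y , _ , _ , y<N , _ = fromℕ< y<N

  rowOf-Row : ∀ j → Row (toℕ j) (toℕ (rowOf j))
  rowOf-Row j with row (toℕ j) (toℕ≤pred[n] j)
  ... | y , R@(_ , _ , y<N , _) = subst (Row (toℕ j)) (sym (toℕ-fromℕ< y<N)) R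

  rowOf-injective : ∀ {j j′} → rowOf j ≡ rowOf j′ → j ≡ j′
  rowOf-injective {j} {j′} e with ℕₚ.<-cmp (toℕ j) (toℕ j′)
  ... | tri≈ _ j≡j′ _ = toℕ-injective j≡j′
  ... | tri< j<j′ _ _ = ⊥-elim (rows-distinct j<j′ (toℕ≤pred[n] j′) (rowOf-Row j)
    (subst (λ z → Row (toℕ j′) (toℕ z)) (sym e) (rowOf-Row j′)))
  ... | tri> _ _ j>j′ = ⊥-elim (rows-distinct j>j′ (toℕ≤pred[n] j) (rowOf-Row j′)
    (subst (λ z → Row (toℕ j) (toℕ z)) e (rowOf-Row j)))

  N≡ : N ≡ suc L
  N≡ = ℕₚ.≤-antisym N≤ (injective⇒≤ rowOf-injective)

  -- Otherwise the column part p i′ alone would have to absorb the step r > q, yet p i′ ≤ p M - p ≤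
  -- q + 1 - p < q.
  rows-increase : ∀ {j y y′} → Row j y → Row (suc j) y′ → y < y′
  rows-increase {j} {y} {y′} (i , _ , _ , e) (i′ , i′<M , _ , e′) with y <? y′
  ... | yes h = h
  ... | no h = ⊥-elim (ℕₚ.<⇒≱ column (ℕₚ.+-cancelʳ-≤ (q * y) q (p * i′) too-far))
    where
    column : p * i′ < q
    column = ℕₚ.+-cancelʳ-< 2 (p * i′) q (begin-strict
      p * i′ + 2        ≤⟨ ℕₚ.+-monoʳ-≤ (p * i′) (subst (2 ≤_) (sym p≡) (s≤s (s≤s z≤n))) ⟩
      p * i′ + p        ≡⟨ trans (ℕₚ.+-comm (p * i′) p) (sym (ℕₚ.*-suc p i′)) ⟩
      p * suc i′          ≤⟨ ℕₚ.*-monoʳ-≤ p i′<M ⟩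
      p * M               ≤⟨ narrow N≡ ⟩
      suc q                 <⟨ ℕₚ.≤-refl ⟩
      suc (suc q)           ≡⟨ ℕₚ.+-comm 2 q ⟩
      q + 2 ∎)
      where open ℕₚ.≤-Reasoning
    too-far : q + q * y ≤ p * i′ + q * y
    too-far = ℕₚ.+-cancelˡ-≤ c _ _ (begin
      c + (q + q * y)                       ≤⟨ ℕₚ.+-monoʳ-≤ c (ℕₚ.+-monoˡ-≤ (q * y) (ℕₚ.<⇒≤ q<r)) ⟩
      c + (r + q * y)                       ≤⟨ ℕₚ.+-monoʳ-≤ c (ℕₚ.+-monoʳ-≤ r (ℕₚ.m≤n+m (q * y) (p * i))) ⟩
      c + (r + (p * i + q * y))         ≡⟨ swap c r (p * i + q * y) ⟩
      r + (c + (p * i + q * y))         ≡⟨ cong (r ℕ.+_) (sym e) ⟩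
      r + (m + r * j)                       ≡⟨ step r m j ⟩
      m + r * suc j                           ≡⟨ e′ ⟩
      c + (p * i′ + q * y′)               ≤⟨ ℕₚ.+-monoʳ-≤ c (ℕₚ.+-monoʳ-≤ (p * i′) (ℕₚ.*-monoʳ-≤ q (ℕₚ.≮⇒≥ h))) ⟩
      c + (p * i′ + q * y) ∎)
      where
      open ℕₚ.≤-Reasoning
      swap : ∀ a b d → a + (b + d) ≡ b + (a + d)
      swap = ℕ-solve-∀
      step : ∀ r m j → r + (m + r * j) ≡ m + r * suc j
      step = ℕ-solve-∀

  -- Each of d further steps gains at least one row, which bounds the present row from above.
  climb : ∀ d {j y} → j + d ≤ L → Row j y → y + d < N
  climb zero {y = y} _ (_ , _ , y<N , _) = subst (_< N) (sym (ℕₚ.+-identityʳ y)) y<N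
  climb (suc d) {j} {y} h R with row (suc j) (ℕₚ.≤-trans (s≤s (ℕₚ.m≤m+n j d)) (ℕₚ.≤-trans (ℕₚ.≤-reflexive (sym (ℕₚ.+-suc j d))) h))
  ... | y′ , R′ = ℕₚ.≤-<-trans (ℕₚ.≤-trans (ℕₚ.≤-reflexive (ℕₚ.+-suc y d))
      (ℕₚ.+-monoˡ-≤ d (rows-increase R R′)))
    (climb d {suc j} (ℕₚ.≤-trans (ℕₚ.≤-reflexive (sym (ℕₚ.+-suc j d))) h) R′)

  -- With N = L + 1, climbing the remaining L - 1 steps leaves room only for row 1 at step 1, hence
  -- row 0 at step 0. Subtracting the two positions gives r ≡ q modulo p.
  first-step : ∃ λ i → ∃ λ i′ → p * i + r ≡ p * i′ + q
  first-step with row 0 z≤n | row 1 0<L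
  ... | y , R@(i , _ , _ , e) | y′ , R′@(i′ , _ , _ , e′) = i , i′ , ℕₚ.+-cancelˡ-≡ c _ _ (begin
    c + (p * i + r)                       ≡⟨ regroup c (p * i) r q ⟩
    c + (p * i + q * 0) + r            ≡⟨ cong (λ z → c + (p * i + q * z) + r) (sym y≡0) ⟩
    c + (p * i + q * y) + r            ≡⟨ cong (_+ r) (sym e) ⟩
    m + r * 0 + r                          ≡⟨ step m r ⟩
    m + r * 1                                ≡⟨ e′ ⟩
    c + (p * i′ + q * y′)                ≡⟨ cong (λ z → c + (p * i′ + q * z)) y′≡1 ⟩
    c + (p * i′ + q * 1)                 ≡⟨ cong (λ z → c + (p * i′ + z)) (ℕₚ.*-identityʳ q) ⟩
    c + (p * i′ + q) ∎)
    where
    open ≡-Reasoning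
    regroup : ∀ c x r q → c + (x + r) ≡ c + (x + q * 0) + r
    regroup = ℕ-solve-∀
    step : ∀ m r → m + r * 0 + r ≡ m + r * 1
    step = ℕ-solve-∀
    y<y′ : y < y′
    y<y′ = rows-increase R R′
    y′≤1 : y′ ≤ 1
    y′≤1 = ℕₚ.+-cancelʳ-≤ (L ∸ 1) y′ 1 (ℕₚ.≤-trans
      (ℕₚ.≤-pred (subst (y′ + (L ∸ 1) <_) N≡
        (climb (L ∸ 1) {1} (ℕₚ.≤-reflexive (ℕₚ.m+[n∸m]≡n 0<L)) R′)))
      (ℕₚ.≤-reflexive (sym (ℕₚ.m+[n∸m]≡n 0<L))))
    y≡0 : y ≡ 0
    y≡0 = ℕₚ.n≤0⇒n≡0 (ℕₚ.≤-pred (ℕₚ.<-≤-trans y<y′ y′≤1))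
    y′≡1 : y′ ≡ 1
    y′≡1 = ℕₚ.≤-antisym y′≤1 (ℕₚ.≤-<-trans z≤n y<y′)

-- The height and the two directions of the equivalence

∣at∣≤height : ∀ f i → ℤ.∣ ⟦ f ⟧ i ∣ ≤ height f
∣at∣≤height [] i = z≤n
∣at∣≤height (a ∷ f) zero = ℕₚ.m≤m⊔n ℤ.∣ a ∣ (height f)
∣at∣≤height (a ∷ f) (suc i) = ℕₚ.≤-trans (∣at∣≤height f i) (ℕₚ.m≤n⊔m ℤ.∣ a ∣ (height f))

height-attained : ∀ f → ∃ λ i → ℤ.∣ ⟦ f ⟧ i ∣ ≡ height f
height-attained [] = 0 , refl
height-attained (a ∷ f) with ℕₚ.⊔-sel ℤ.∣ a ∣ (height f)
... | inj₁ e = 0 , sym e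
... | inj₂ e with height-attained f
...   | i , e′ = suc i , trans e′ (sym e)

-- The bound on r appears with its denominator p - 2 cleared.
Condition : ℕ → ℕ → ℕ → Set
Condition p q r = (((p ∣ q ∸ 1) × (p ∣ r ∸ 1)) ⊎ ((p ∣ q + 1) × (p ∣ r + 1)))
  × (r * (p ∸ 2) < (p ∸ 1) * (q ∸ 1))

-- The factorization is taken for every split: necessity starts from the one given by coprimality,
-- sufficiency builds one with γ′ = 1 or γ = 1.
module Main {L q₁ r₁ : ℕ}
            (pp : Prime (suc (suc L))) (pq : Prime (suc q₁)) (pr : Prime (suc r₁))
            (0<L : 0 < L) (p<q : suc (suc L) < suc q₁) (q<r : suc q₁ < suc r₁) (Ψ′ : Poly)
            (factorization : ∀ (s : Split (suc (suc L)) (suc q₁)) →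
              ⟦ Ψ′ ⟧ ≐ (X (suc r₁ * suc q₁) ⊕ ⊖ 𝟙) ⋆ (geo (suc r₁) (suc (suc L)) ⋆ binary s 1)) where

  private
    p = suc (suc L)
    q = suc q₁
    r = suc r₁
    p<r = ℕₚ.<-trans p<q q<r
    p⊥q = primes-coprime pp pq (ℕₚ.<⇒≢ p<q)
    p⊥r = primes-coprime pp pr (ℕₚ.<⇒≢ p<r)
    q₁<r = ℕₚ.<-trans (ℕₚ.n<1+n q₁) q<r

  module _ (s : Split p q) where
    open BinaryCoefficients (prime>1 pp) p⊥q s

    private
      coefficient-small : ∀ {k z} → Coefficient k z → z ≡ + 0 ⊎ Sign z
      coefficient-small (positive _) = inj₂ plus
      coefficient-small (negative _) = inj₂ minus
      coefficient-small neither = inj₁ refl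

      degree≤ : ∀ k → ¬ (binary s 1 k ≡ + 0) → k ≤ suc L * q₁
      degree≤ k nz = ℕₚ.+-cancelʳ-≤ (p + q) k _
        (ℕₚ.≤-trans (degree-bound (coefficient k) nz) (ℕₚ.≤-reflexive (expand L q₁)))
        where
        expand : ∀ L q₁ → suc (suc (suc L) * suc q₁) ≡ suc L * q₁ + (suc (suc L) + suc q₁)
        expand = ℕ-solve-∀

    module W = Window L q₁ r p<q q₁<r (binary s 1) (λ k → coefficient-small (coefficient k)) degree≤

    Ψ≐ψ : ⟦ Ψ′ ⟧ ≐ W.ψ
    Ψ≐ψ = factorization s

    height≤ : height Ψ′ ≤ suc L
    height≤ with height-attained Ψ′
    ... | k , e = subst (_≤ suc L) (trans (cong ℤ.∣_∣ (sym (coeff Ψ≐ψ k))) e) (W.∣ψ∣≤ k)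

    height≥ : ∀ k → ℤ.∣ W.ψ k ∣ ≡ suc L → suc L ≤ height Ψ′
    height≥ k e = subst (_≤ height Ψ′)
      (trans (cong ℤ.∣_∣ (coeff Ψ≐ψ k)) e) (∣at∣≤height Ψ′ k)

    necessary : ∀ k → ℤ.∣ W.ψ k ∣ ≡ suc L → Condition p q r
    necessary k e = condition (W.progression k e)
      where
      -- Makes the degree bound strict: the prime r would divide p - 1 or q - 1, both positive and
      -- smaller than r.
      r*L≢ : ¬ (r * L ≡ suc L * q₁)
      r*L≢ e with euclidsLemma (suc L) q₁ pr (subst (r ∣_) e (m∣m*n L))
      ... | inj₁ d = ℕₚ.<⇒≱ p<r (ℕₚ.≤-trans (∣⇒≤ d) (ℕₚ.n≤1+n _))
      ... | inj₂ d = ℕₚ.<⇒≱ q₁<r (∣⇒≤ ⦃ ℕ.>-nonZero (ℕₚ.≤-<-trans z≤n (ℕₚ.≤-pred p<q)) ⦄ d)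

      open Split s

      coefficient-1 : ∀ {k z} → Coefficient k z → z ≡ + 1 → Positive k
      coefficient-1 (positive g) _ = g

      coefficient--1 : ∀ {k z} → Coefficient k z → z ≡ -[1+ 0 ] → Negative k
      coefficient--1 (negative g) _ = g

      other-row : ∀ {x y} → p ≡ x + y → x ≡ suc L → y ≡ 1
      other-row {y = y} e refl = ℕₚ.+-cancelˡ-≡ (suc L) y 1 (trans (sym e) (ℕₚ.+-comm 1 (suc L)))

      row-bound : ∀ {x y} → p ≡ x + y → ¬ (y ≡ 0) → x ≤ suc L
      row-bound {y = zero} _ nz = ⊥-elim (nz refl)
      row-bound {x} {suc y} e _ = ℕₚ.≤-pred (subst (suc x ≤_)
        (trans (sym (ℕₚ.+-suc x y)) (sym e)) (s≤s (ℕₚ.m≤m+n x y)))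

      congruences : ∀ {ε m} → Sign ε → (∀ j → j ≤ L → binary s 1 (m + r * j) ≡ ε) →
        ((p ∣ q ∸ 1) × (p ∣ r ∸ 1)) ⊎ ((p ∣ q + 1) × (p ∣ r + 1))
      -- Here γ = p - 1 leaves γ′ = 1, so `a*α≡` reads p α = q + 1, which is both the divisibility
      -- and the narrowness of the grid.
      congruences {m = m} plus f≡ = inj₂ (subst (p ∣_) p*α≡q+1 (m∣m*n α) , p∣r+1 first-step)
        where
        γ′≢0 : ¬ (γ′ ≡ 0)
        γ′≢0 refl = ℕₚ.<⇒≢ (prime>1 pp) (sym (∣1⇒≡1
          (subst (p ∣_) (trans a*α≡ (cong suc (ℕₚ.*-zeroʳ q))) (m∣m*n α))))
        p*α≡ : γ ≡ suc L → p * α ≡ suc q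
        p*α≡ e = trans a*α≡ (cong suc (trans (cong (q *_) (other-row a≡ e)) (ℕₚ.*-identityʳ q)))
        open GridProgression {L} {p} {q} {r} {m} {0} {α} {γ} refl 0<L p⊥r q<r (row-bound a≡ γ′≢0)
          (λ e → ℕₚ.≤-reflexive (p*α≡ e))
          (λ j j≤L → _ , refl , coefficient-1 (coefficient _) (f≡ j j≤L))
        p*α≡q+1 : p * α ≡ q + 1
        p*α≡q+1 = trans (p*α≡ N≡) (ℕₚ.+-comm 1 q)
        p∣r+1 : (∃ λ i → ∃ λ i′ → p * i + r ≡ p * i′ + q) → p ∣ r + 1
        p∣r+1 (i , i′ , e) = ∣m+n∣m⇒∣n (subst (p ∣_) (begin
          p * i′ + p * α     ≡⟨ cong (p * i′ ℕ.+_) p*α≡q+1 ⟩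
          p * i′ + (q + 1)   ≡⟨ sym (ℕₚ.+-assoc (p * i′) q 1) ⟩
          p * i′ + q + 1     ≡⟨ cong (_+ 1) (sym e) ⟩
          p * i + r + 1      ≡⟨ ℕₚ.+-assoc (p * i) r 1 ⟩
          p * i + (r + 1) ∎) (∣m∣n⇒∣m+n (m∣m*n i′) (m∣m*n α))) (m∣m*n i)
          where open ≡-Reasoning
      -- Here γ′ = p - 1 leaves γ = 1, so `b*γ≡` reads q = 1 + p α′.
      congruences {m = m} minus f≡ = inj₁ (subst (p ∣_) p*α′≡q₁ (m∣m*n α′) , p∣r₁ first-step)
        where
        a≡′ : p ≡ γ′ + γ
        a≡′ = trans a≡ (ℕₚ.+-comm γ γ′)
        γ≢0 : ¬ (γ ≡ 0)
        γ≢0 refl with trans (sym (ℕₚ.*-zeroʳ q)) b*γ≡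
        ... | ()
        p*α′≡ : γ′ ≡ suc L → p * α′ ≡ q₁
        p*α′≡ e = ℕₚ.suc-injective (trans (sym b*γ≡)
          (trans (cong (q *_) (other-row a≡′ e)) (ℕₚ.*-identityʳ q)))
        open GridProgression {L} {p} {q} {r} {m} {1} {α′} {γ′} refl 0<L p⊥r q<r (row-bound a≡′ γ≢0)
          (λ e → ℕₚ.≤-trans (ℕₚ.≤-reflexive (p*α′≡ e)) (ℕₚ.≤-trans (ℕₚ.n≤1+n q₁) (ℕₚ.n≤1+n q)))
          (λ j j≤L → coefficient--1 (coefficient _) (f≡ j j≤L))
        p*α′≡q₁ : p * α′ ≡ q₁
        p*α′≡q₁ = p*α′≡ N≡
        p∣r₁ : (∃ λ i → ∃ λ i′ → p * i + r ≡ p * i′ + q) → p ∣ r₁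
        p∣r₁ (i , i′ , e) = ∣m+n∣m⇒∣n (subst (p ∣_)
          (trans (cong (p * i′ ℕ.+_) p*α′≡q₁) (ℕₚ.suc-injective
            (trans (sym (ℕₚ.+-suc (p * i′) q₁)) (trans (sym e) (ℕₚ.+-suc (p * i) r₁)))))
          (∣m∣n⇒∣m+n (m∣m*n i′) (m∣m*n α′))) (m∣m*n i)

      condition : (∃ λ ε → Sign ε × ∃ λ m → ∀ j → j ≤ L → binary s 1 (m + r * j) ≡ ε) →
        Condition p q r
      condition (ε , sgn , m , f≡) = congruences {m = m} sgn f≡ ,
        -- The last degree m + r L carries a nonzero coefficient, so r L is at most (p - 1)(q - 1).
        ℕₚ.≤∧≢⇒< (ℕₚ.≤-trans (ℕₚ.m≤n+m (r * L) m)
          (degree≤ _ λ z → sign≢0 sgn (trans (sym (f≡ L ℕₚ.≤-refl)) z))) r*L≢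

  -- With r = q + p h the translates in question lie in the rows 0, …, L and the columns 0, h, …, L h.
  module _ (h : ℕ) (r≡ : r ≡ q + p * h) (bound : r * L < suc L * q₁) where

    -- Substituting r = q + p h turns the bound into L + p h L < q - 1, so the last column h L fits
    -- into a grid of width M with p M ≥ q - 1.
    p*[h*L]<q₁ : p * (h * L) < q₁
    p*[h*L]<q₁ = ℕₚ.+-cancelʳ-< (L * q₁) (p * (h * L)) q₁ (ℕₚ.≤-<-trans
      (ℕₚ.≤-trans (ℕₚ.m≤n+m _ L) (ℕₚ.≤-reflexive (trans (expand L q₁ p h) (cong (_* L) (sym r≡))))) bound)
      where
      expand : ∀ L q₁ p h → L + (p * (h * L) + L * q₁) ≡ (suc q₁ + p * h) * L
      expand = ℕ-solve-∀

    progression-grid : ∀ {M N} → q₁ ≤ p * M → suc L ≤ N → ∀ j → j ≤ L → Grid p q M N (r * j)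
    progression-grid {M} q₁≤ N≥ j j≤L = h * j , j ,
      ℕₚ.≤-<-trans (ℕₚ.*-monoʳ-≤ h j≤L) (ℕₚ.*-cancelˡ-< p _ M (ℕₚ.<-≤-trans p*[h*L]<q₁ q₁≤)) ,
      ℕₚ.≤-trans (s≤s j≤L) N≥ ,
      trans (cong (_* j) r≡) (expand q p h j)
      where
      expand : ∀ q p h j → (q + p * h) * j ≡ p * (h * j) + q * j
      expand = ℕ-solve-∀

  difference : ∀ {a b} → a ≤ b → p ∣ a → p ∣ b → ∃ λ h → b ≡ a + p * h
  difference {a} {b} a≤b p∣a p∣b with ∣m+n∣m⇒∣n (subst (p ∣_) (sym (ℕₚ.m+[n∸m]≡n a≤b)) p∣b) p∣a
  ... | divides h e = h , trans (sym (ℕₚ.m+[n∸m]≡n a≤b)) (cong (a ℕ.+_) (trans e (ℕₚ.*-comm h p)))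

  sufficient⁺ : p ∣ q + 1 → r * L < suc L * q₁ →
    (∃ λ h → r + 1 ≡ q + 1 + p * h) → suc L ≤ height Ψ′
  sufficient⁺ (divides α q+1≡) bound (h , r+1≡) =
    height≥ s (0 + r * L) (W.attained s plus (s≤s z≤n) λ j j≤L →
      BinaryCoefficients.positive⇒1 (prime>1 pp) p⊥q s
        (progression-grid h r≡ bound q₁≤p*α ℕₚ.≤-refl j j≤L))
    where
    r≡ : r ≡ q + p * h
    r≡ = ℕₚ.+-cancelʳ-≡ 1 r _ (trans r+1≡ (swap q (p * h)))
      where
      swap : ∀ a b → a + 1 + b ≡ a + b + 1
      swap = ℕ-solve-∀
    p*α≡ : p * α ≡ suc q
    p*α≡ = trans (ℕₚ.*-comm p α) (trans (sym q+1≡) (ℕₚ.+-comm q 1))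
    q₁≤p*α : q₁ ≤ p * α
    q₁≤p*α = ℕₚ.≤-trans (ℕₚ.n≤1+n q₁) (ℕₚ.≤-trans (ℕₚ.n≤1+n q) (ℕₚ.≤-reflexive (sym p*α≡)))
    α<q : α < q
    α<q = ℕₚ.*-cancelˡ-< p α q (begin-strict
      p * α        ≡⟨ trans p*α≡ (ℕₚ.+-comm 1 q) ⟩
      q + 1        <⟨ ℕₚ.+-monoʳ-< q (ℕₚ.<-trans (prime>1 pp) p<q) ⟩
      q + q        ≤⟨ ℕₚ.+-monoʳ-≤ q (ℕₚ.m≤m+n q (L * q)) ⟩
      p * q ∎)
      where open ℕₚ.≤-Reasoning
    -- Choosing γ′ = 1 makes the positive grid p - 1 rows high.
    s : Split p q
    s = inverse⇒split α 1 α<q (trans p*α≡ (cong suc (sym (ℕₚ.*-identityʳ q))))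

  sufficient⁻ : p ∣ q₁ → r * L < suc L * q₁ →
    (∃ λ h → r₁ ≡ q₁ + p * h) → suc L ≤ height Ψ′
  sufficient⁻ (divides β q₁≡) bound (h , r₁≡) =
    -- The offset 1 comes from the factor x in front of the negative grid.
    height≥ s (1 + r * L) (W.attained s minus (ℕₚ.<-trans (prime>1 pp) p<r) λ j j≤L →
      BinaryCoefficients.negative⇒-1 (prime>1 pp) p⊥q s
        (_ , refl , progression-grid h (cong suc r₁≡) bound
          (ℕₚ.≤-reflexive (trans q₁≡ (ℕₚ.*-comm β p))) ℕₚ.≤-refl j j≤L))
    where
    -- Since q = 1 + p β, the number 1 inverts q modulo p; after the swap γ = 1, and the negative
    -- grid has p - 1 rows and β columns.
    s : Split p q
    s = split-swap (inverse⇒split 1 β (prime>1 pp)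
      (trans (ℕₚ.*-identityʳ q) (cong suc (trans q₁≡ (ℕₚ.*-comm β p)))))

  sufficient : Condition p q r → suc L ≤ height Ψ′
  sufficient (inj₁ (p∣q₁ , p∣r₁) , bound) =
    sufficient⁻ p∣q₁ bound (difference (ℕₚ.≤-pred (ℕₚ.<⇒≤ q<r)) p∣q₁ p∣r₁)
  sufficient (inj₂ (p∣q+1 , p∣r+1) , bound) =
    sufficient⁺ p∣q+1 bound (difference (ℕₚ.+-monoˡ-≤ 1 (ℕₚ.<⇒≤ q<r)) p∣q+1 p∣r+1)

  conclusion : (height Ψ′ ≡ suc L ⇔ Condition p q r)
    × (¬ Condition p q r → height Ψ′ < suc L)
  conclusion = mk⇔ to (λ c → ℕₚ.≤-antisym (height≤ s) (sufficient c)) ,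
    λ ¬c → ℕₚ.≤∧≢⇒< (height≤ s) λ e → ¬c (to e)
    where
    s = coprime⇒split (prime>1 pp) (prime>1 pq) p⊥q
    to : height Ψ′ ≡ suc L → Condition p q r
    to e with height-attained Ψ′
    ... | k , e′ = necessary s k (trans (cong ℤ.∣_∣ (sym (coeff (Ψ≐ψ s) k))) (trans e′ e))

theorem2 : (p q r : ℕ) → Prime p → Prime q → Prime r
    → ¬ (2 ∣ p) → ¬ (2 ∣ q) → ¬ (2 ∣ r) → p < q → q < r
    → (height (Ψ (p * q * r)) ≡ p ∸ 1
    ⇔ ((((p ∣ q ∸ 1) × (p ∣ r ∸ 1)) ⊎ ((p ∣ q + 1) × (p ∣ r + 1)))
    × (r * (p ∸ 2) < (p ∸ 1) * (q ∸ 1))))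
    × (¬ ((((p ∣ q ∸ 1) × (p ∣ r ∸ 1)) ⊎ ((p ∣ q + 1) × (p ∣ r + 1)))
    × (r * (p ∸ 2) < (p ∸ 1) * (q ∸ 1)))
    → height (Ψ (p * q * r)) < p ∸ 1)
theorem2 0 _ _ pp _ _ _ _ _ _ _ with prime>1 pp
... | ()
theorem2 1 _ _ pp _ _ _ _ _ _ _ with prime>1 pp
... | s≤s ()
-- With p odd, p ≥ 3 remains, so L = p - 2 ≥ 1 and the progression has a first step to compare r
-- with q.
theorem2 2 _ _ _ _ _ 2∤p _ _ _ _ = ⊥-elim (2∤p ∣-refl)
theorem2 p@(suc (suc (suc _))) q@(suc _) r@(suc _) pp pq pr _ _ _ p<q q<r =
  Main.conclusion pp pq pr (s≤s z≤n) p<q q<r (Ψ (p * q * r)) λ s →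
    ≐-trans (ThreePrimes.Ψ-factor pp pq pr p<q q<r)
      (⋆-cong ≐-refl (⋆-cong ≐-refl (P-pq≐binary pp pq (ℕₚ.<⇒≢ p<q) s)))
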